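{- Let $k\ge1$, $r\ge2$ and $n\ge rk$ be integers, and let $t$ be an integer with $t\le r(k-2)+1$. Then $$\chi(\mathrm{KG}^r(n,k)_{t\text{ -wide}})=\left\lceil\frac{n-r(k-1)}{r-1}\right\rceil.$$
   Context: $\mathrm{KG}^r(n,k)$ is the $r$-uniform Kneser hypergraph whose vertices are all $k$-subsets of $[n]$ and whose edges are all $r$-subsets $\{F_1,\dots,F_r\}$ of pairwise disjoint vertices. $\mathrm{KG}^r(n,k)_{t\text{ -wide}}$ is its sub-hypergraph induced by the $k$-subsets that are not contained in any of the sets $\{i,i+1,\dots,i+t-1\}$ for $i\in[n-t+1]$. $\chi$ is the chromatic number (minimum number of colors in a vertex coloring with no monochromatic edge). -}

module Defs where

open import Data.Nat as ℕ using (ℕ; zero; suc; _∸_; NonZero)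
open import Data.Nat.DivMod using (_/_)
open import Data.Integer as ℤ using (ℤ; +_)
open import Data.Fin using (Fin; toℕ)
open import Data.Fin.Subset using (Subset; _∈_; ∣_∣; _∩_; Empty)
open import Data.Product using (Σ; _×_; ∃)
open import Relation.Nullary using (¬_)
open import Relation.Binary.PropositionalEquality using (_≡_)

⌈_/_⌉ : (a b : ℕ) → .{{NonZero b}} → ℕ
⌈ a / b ⌉ = (a ℕ.+ (b ∸ 1)) / b

-- The ground set [n] = {1,…,n} is modelled by Fin n, element j ↦ toℕ j + 1.
-- F ⊆ {i, i+1, …, i+t-1} (integers i, t).
InInterval : {n : ℕ} → Subset n → ℤ → ℤ → Set
InInterval {n} F i t =
  ∀ (j : Fin n) → j ∈ F →
    (i ℤ.≤ + (suc (toℕ j))) × (+ (suc (toℕ j)) ℤ.≤ i ℤ.+ t ℤ.- ℤ.1ℤ)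

InSomeWindow : {n : ℕ} → Subset n → ℤ → Set
InSomeWindow {n} F t =
  ∃ λ (i : ℤ) → (ℤ.1ℤ ℤ.≤ i) × (i ℤ.≤ + n ℤ.- t ℤ.+ ℤ.1ℤ) × InInterval F i t

IsWideVertex : (n k : ℕ) (t : ℤ) → Subset n → Set
IsWideVertex n k t F = (∣ F ∣ ≡ k) × ¬ InSomeWindow F t

-- A proper c-colouring of KG^r(n,k)_{t-wide}: every edge, i.e. every
-- family of r pairwise disjoint vertices F₁,…,F_r, is not monochromatic.
-- (Pairwise disjoint k-sets with k ≥ 1 are automatically distinct, so an
-- injective Fin r-indexed family is exactly an r-subset of vertices.)
ProperColouring : (n k r : ℕ) (t : ℤ) (c : ℕ) →
  ((F : Subset n) → IsWideVertex n k t F → Fin c) → Set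
ProperColouring n k r t c col =
  ∀ (F : Fin r → Subset n) (v : ∀ a → IsWideVertex n k t (F a)) →
    (∀ a b → ¬ a ≡ b → Empty (F a ∩ F b)) →
    ¬ (∀ a b → col (F a) (v a) ≡ col (F b) (v b))

Colourable : (n k r : ℕ) (t : ℤ) (c : ℕ) → Set
Colourable n k r t c =
  Σ ((F : Subset n) → IsWideVertex n k t F → Fin c) (ProperColouring n k r t c)

ChromaticNumberIs : (n k r : ℕ) (t : ℤ) (m : ℕ) → Set
ChromaticNumberIs n k r t m =
  Colourable n k r t m × (∀ c → Colourable n k r t c → m ℕ.≤ c)

pred-nonZero : {r : ℕ} → 2 ℕ.≤ r → NonZero (r ∸ 1)
pred-nonZero (ℕ.s≤s (ℕ.s≤s _)) = _

{-# OPTIONS --safe #-}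
module Submission where

-- The blocks {1,…,r}, {r+1,…,2r}, … of length r are so long that a k-set meeting each of
-- them at most once is t-wide, so the lower bound follows from an Alon–Frankl–Lovász theorem
-- for k-sets transversal to a partition into blocks of size at most r. If it holds for a and
-- b then it holds for a b, so r may be a prime p. Suppose that some colouring with c colours
-- has no p disjoint transversal k-sets of one colour. A nonzero vector X in (Z_p ∪ {0})ᵐ
-- defines p disjoint sets; let its level be the number of pairs (block, sign) that occur in
-- X if this is at most p (k − 1), and otherwise p (k − 1) plus the number of pairs
-- (colour, sign) such that the set of this sign contains a transversal k-set of this colour.
-- Levels are monotone and at most p (k − 1) + c (p − 1), and there is a Z_p-equivariant sign
-- that is constant on chains of constant level. A Z_p-Tucker lemma forbids this when m is
-- larger: evaluating powers of the generators of the cohomology of Z_p on explicit chains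
-- produces, for every equivariant sign, a chain of m vectors whose consecutive signs differ.

-- The obstacle is a rotation-invariant row of signs, from which no sign can be chosen
-- equivariantly. A set of j signs with 0 < j < p is harmless: rotation adds j to the sum of its
-- signs modulo p, and j is invertible because p is prime. Only the row of all p signs remains. For
-- a colour, that row is the monochromatic family sought. For a block, it is the reason for the
-- bound on the block size: the block then carries each sign exactly once, and the sign at its first
-- position can be used, since it is frozen in all larger vectors. The threshold p (k - 1) is a
-- pigeonhole bound: with one more pair (block, sign), some sign occurs in k blocks and its set
-- contains a transversal k-set. The Tucker lemma itself holds for every r ≥ 2; its cochains are
-- integral because its induction divides by r.

module ZrTucker where
  open import Data.Nat as ℕ using (ℕ; zero; suc)
  import Data.Nat.Properties as ℕ
  import Data.Nat.DivMod as ℕ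
  open import Data.Integer as ℤ using (ℤ; +_; _+_; _-_; _*_; 0ℤ; 1ℤ; -1ℤ)
  import Data.Integer.Properties as ℤ
  open import Data.Integer.Tactic.RingSolver using (solve-∀)
  open import Data.Fin using (Fin; zero; suc; toℕ; fromℕ<)
  open import Data.Fin.Properties using (toℕ-fromℕ<; toℕ-injective; toℕ<n)
  open import Data.List using (List; []; _∷_; map; length)
  open import Data.List.Properties using (map-∘; map-cong; map-id; length-map)
  open import Data.List.Relation.Unary.Linked as Linked using (Linked; [-]; _∷_)
  import Data.List.Relation.Unary.Linked.Properties as Linked
  open import Data.Bool using (if_then_else_; true; false; T)
  open import Data.Empty using (⊥; ⊥-elim)
  open import Data.Product using (∃; _,_)
  open import Data.Sum using (_⊎_; inj₁; inj₂)
  open import Data.Unit using (tt)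
  open import Function using (_∘_)
  open import Relation.Nullary using (¬_; yes; no)
  open import Relation.Binary.PropositionalEquality
  open ≡-Reasoning

  -- Ordered cochains, group ring operators and a contracting homotopy.

  private variable
    A B : Set

  -- One function carries all degrees at once: a list of length n + 1 is an ordered n-simplex, and
  -- the empty list is the augmentation in degree -1.
  Cochain : Set → Set
  Cochain A = List A → ℤ

  -- Respect for pointwise equality is part of linearity, since cochains with equal values are not
  -- identified as functions.
  record Linear (F : Cochain A → ℤ) : Set where
    field
      ext    : ∀ {φ ψ} → (∀ l → φ l ≡ ψ l) → F φ ≡ F ψ
      linear : ∀ a b φ ψ → F (λ l → a * φ l + b * ψ l) ≡ a * F φ + b * F ψ

    scale : ∀ a φ → F (λ l → a * φ l) ≡ a * F φ
    scale a φ = begin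
      F (λ l → a * φ l)                ≡⟨ ext (λ l → ring a (φ l)) ⟩
      F (λ l → a * φ l + 0ℤ * φ l)     ≡⟨ linear a 0ℤ φ φ ⟩
      a * F φ + 0ℤ * F φ               ≡⟨ ring a (F φ) ⟨
      a * F φ                          ∎
      where ring : ∀ a x → a * x ≡ a * x + 0ℤ * x
            ring = solve-∀

    diff : ∀ φ ψ → F (λ l → φ l - ψ l) ≡ F φ - F ψ
    diff φ ψ = begin
      F (λ l → φ l - ψ l)               ≡⟨ ext (λ l → ring (φ l) (ψ l)) ⟩
      F (λ l → 1ℤ * φ l + -1ℤ * ψ l)    ≡⟨ linear 1ℤ -1ℤ φ ψ ⟩
      1ℤ * F φ + -1ℤ * F ψ              ≡⟨ ring (F φ) (F ψ) ⟨
      F φ - F ψ                         ∎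
      where ring : ∀ x y → x - y ≡ 1ℤ * x + -1ℤ * y
            ring = solve-∀

    vanish : F (λ _ → 0ℤ) ≡ 0ℤ
    vanish = trans (diff (λ _ → 0ℤ) (λ _ → 0ℤ)) (ℤ.+-inverseʳ (F (λ _ → 0ℤ)))

  open Linear public

  ev-linear : (l : List A) → Linear (λ φ → φ l)
  ev-linear l .ext eq = eq l
  ev-linear l .linear a b φ ψ = refl

  0-linear : Linear {A} (λ _ → 0ℤ)
  0-linear .ext _ = refl
  0-linear .linear a b _ _ = ring a b
    where ring : ∀ a b → 0ℤ ≡ a * 0ℤ + b * 0ℤ
          ring = solve-∀

  +-linear : {F G : Cochain A → ℤ} → Linear F → Linear G → Linear (λ φ → F φ + G φ)
  +-linear L M .ext eq = cong₂ _+_ (L .ext eq) (M .ext eq)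
  +-linear {F = F} {G} L M .linear a b φ ψ =
    trans (cong₂ _+_ (L .linear a b φ ψ) (M .linear a b φ ψ)) (ring a b (F φ) (F ψ) (G φ) (G ψ))
    where ring : ∀ a b x y z w → (a * x + b * y) + (a * z + b * w) ≡ a * (x + z) + b * (y + w)
          ring = solve-∀

  −-linear : {F G : Cochain A → ℤ} → Linear F → Linear G → Linear (λ φ → F φ - G φ)
  −-linear L M .ext eq = cong₂ _-_ (L .ext eq) (M .ext eq)
  −-linear {F = F} {G} L M .linear a b φ ψ =
    trans (cong₂ _-_ (L .linear a b φ ψ) (M .linear a b φ ψ)) (ring a b (F φ) (F ψ) (G φ) (G ψ))
    where ring : ∀ a b x y z w → (a * x + b * y) - (a * z + b * w) ≡ a * (x - z) + b * (y - w)
          ring = solve-∀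

  ∘-linear : {F : Cochain A → ℤ} {O : Cochain B → Cochain A} →
             Linear F → (∀ l → Linear (λ φ → O φ l)) → Linear (λ φ → F (O φ))
  ∘-linear L M .ext eq = L .ext (λ l → M l .ext eq)
  ∘-linear L M .linear a b φ ψ =
    trans (L .ext (λ l → M l .linear a b φ ψ)) (L .linear a b _ _)

  prefix : A → Cochain A → Cochain A
  prefix x φ l = φ (x ∷ l)

  pull : (A → B) → Cochain B → Cochain A
  pull f φ l = φ (map f l)

  -- Unfolds to the alternating sum over deletions of one entry. Freezing the first entry with
  -- `prefix` turns every identity for `δ` into an induction on the list.
  δ : Cochain A → Cochain A
  δ φ [] = 0ℤ
  δ φ (x ∷ l) = φ l - δ (prefix x φ) l

  δ-linear : (l : List A) → Linear (λ φ → δ φ l)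
  δ-linear [] = 0-linear
  δ-linear (x ∷ l) = −-linear (ev-linear l) (∘-linear (δ-linear l) (λ l′ → ev-linear (x ∷ l′)))

  δ-pull : (f : A → B) (φ : Cochain B) → ∀ l → δ (pull f φ) l ≡ pull f (δ φ) l
  δ-pull f φ [] = refl
  δ-pull f φ (x ∷ l) = cong (λ z → φ (map f l) - z) (δ-pull f (prefix (f x) φ) l)

  iter : ℕ → (A → A) → A → A
  iter zero f x = x
  iter (suc n) f x = iter n f (f x)

  module _ (t : A → A) where
    Δ : Cochain A → Cochain A
    Δ φ l = φ (map t l) - φ l

    N : ℕ → Cochain A → Cochain A
    N zero φ l = 0ℤ
    N (suc k) φ l = φ l + N k φ (map t l)

    Δ-linear : ∀ l → Linear (λ φ → Δ φ l)
    Δ-linear l = −-linear (ev-linear (map t l)) (ev-linear l)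

    N-linear : ∀ k l → Linear (λ φ → N k φ l)
    N-linear zero l = 0-linear
    N-linear (suc k) l = +-linear (ev-linear l) (N-linear k (map t l))

    δ-Δ : ∀ φ l → δ (Δ φ) l ≡ Δ (δ φ) l
    δ-Δ φ l = trans (diff (δ-linear l) (pull t φ) φ) (cong (_- δ φ l) (δ-pull t φ l))

    N-pull : ∀ k φ l → N k (pull t φ) l ≡ N k φ (map t l)
    N-pull zero φ l = refl
    N-pull (suc k) φ l = cong (λ z → φ (map t l) + z) (N-pull k φ (map t l))

    N-telescope : ∀ k φ l → N k (Δ φ) l ≡ φ (iter k (map t) l) - φ l
    N-telescope zero φ l = sym (ℤ.+-inverseʳ (φ l))
    N-telescope (suc k) φ l =
      trans (cong (λ z → Δ φ l + z) (N-telescope k φ (map t l))) (ring (φ (map t l)) (φ l) (φ (iter k (map t) (map t l))))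
      where ring : ∀ x y z → (x - y) + (z - x) ≡ z - y
            ring = solve-∀

    Δ-N : ∀ k φ l → Δ (N k φ) l ≡ N k (Δ φ) l
    Δ-N k φ l = sym (trans (diff (N-linear k l) (pull t φ) φ) (cong (_- N k φ l) (N-pull k φ l)))

    δ-N : ∀ k φ l → δ (N k φ) l ≡ N k (δ φ) l
    δ-N zero φ l = vanish (δ-linear l)
    δ-N (suc k) φ l = begin
      δ (N (suc k) φ) l                 ≡⟨ δ-linear l .ext (λ l′ → ring (φ l′) (N k φ (map t l′))) ⟩
      δ (λ l′ → 1ℤ * φ l′ + 1ℤ * pull t (N k φ) l′) l
                                        ≡⟨ δ-linear l .linear 1ℤ 1ℤ φ (pull t (N k φ)) ⟩
      1ℤ * δ φ l + 1ℤ * δ (pull t (N k φ)) l  ≡⟨ ring (δ φ l) _ ⟨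
      δ φ l + δ (pull t (N k φ)) l      ≡⟨ cong (λ z → δ φ l + z) (δ-pull t (N k φ) l) ⟩
      δ φ l + δ (N k φ) (map t l)       ≡⟨ cong (λ z → δ φ l + z) (δ-N k φ (map t l)) ⟩
      N (suc k) (δ φ) l                 ∎
      where ring : ∀ x y → x + y ≡ 1ℤ * x + 1ℤ * y
            ring = solve-∀

    N-invariant : ∀ k φ → (∀ l → φ (map t l) ≡ φ l) → ∀ l → N k φ l ≡ + k * φ l
    N-invariant zero φ inv l = refl
    N-invariant (suc k) φ inv l = begin
      φ l + N k φ (map t l)     ≡⟨ cong (λ z → φ l + z) (N-invariant k φ inv (map t l)) ⟩
      φ l + + k * φ (map t l)   ≡⟨ cong (λ z → φ l + + k * z) (inv l) ⟩
      φ l + + k * φ l           ≡⟨ ring (+ k) (φ l) ⟩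
      + suc k * φ l             ∎
      where ring : ∀ a x → x + a * x ≡ (1ℤ + a) * x
            ring = solve-∀

  iter-map : ∀ k (f : A → A) l → iter k (map f) l ≡ map (iter k f) l
  iter-map zero f l = sym (map-id l)
  iter-map (suc k) f l = trans (iter-map k f (map f l)) (sym (map-∘ l))

  iter-map-id : ∀ k (f : A → A) → (∀ x → iter k f x ≡ x) → ∀ l → iter k (map f) l ≡ l
  iter-map-id k f eq l = trans (iter-map k f l) (trans (map-cong eq l) (map-id l))

  -- The cone with apex e over the prism between ι and κ; the corresponding
  -- homotopy identity contracts the image of ι.
  module _ (ι κ : A → B) (e : B) where
    Q : Cochain B → Cochain A
    Q φ [] = 0ℤ
    Q φ (x ∷ l) = φ (ι x ∷ κ x ∷ map κ l) - Q (prefix (ι x) φ) l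

    K : Cochain B → Cochain A
    K φ l = φ (e ∷ map κ l) - Q φ l

    Q-linear : ∀ l → Linear (λ φ → Q φ l)
    Q-linear [] = 0-linear
    Q-linear (x ∷ l) = −-linear (ev-linear _) (∘-linear (Q-linear l) (λ l′ → ev-linear (ι x ∷ l′)))

    K-linear : ∀ l → Linear (λ φ → K φ l)
    K-linear l = −-linear (ev-linear _) (Q-linear l)

    -- After splitting off the first vertex, `Q φ l` and `δ φ″ (map κ l)` each occur twice with
    -- opposite signs. What is left is the identity for `φ′`, whose term `φικ` cancels as well.
    Q-homotopy : ∀ φ l → Q (δ φ) l + δ (Q φ) l ≡ pull κ φ l - pull ι φ l
    Q-homotopy φ [] = sym (ℤ.+-inverseʳ (φ []))
    Q-homotopy φ (x ∷ l) =
      trans (cong₂ step Q-tail δ-tail)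
        (trans (ring φκ φικ (δ φ″ (map κ l)) (Q φ l) (Q (δ φ′) l) (δ (Q φ′) l))
          (trans (cong (λ z → φκ - φικ + z) (Q-homotopy φ′ l)) (ring′ φκ φικ _)))
      where
      φ′ = prefix (ι x) φ
      φ″ = prefix (κ x) φ′
      φκ = φ (κ x ∷ map κ l)
      φικ = φ (ι x ∷ map κ l)
      step : ℤ → ℤ → ℤ
      step y z = (φκ - (φικ - δ φ″ (map κ l)) - y) + (Q φ l - z)
      Q-tail : Q (prefix (ι x) (δ φ)) l ≡ Q φ l - Q (δ φ′) l
      Q-tail = diff (Q-linear l) φ (δ φ′)
      δ-tail : δ (prefix x (Q φ)) l ≡ δ φ″ (map κ l) - δ (Q φ′) l
      δ-tail = trans (diff (δ-linear l) (pull κ φ″) (Q φ′)) (cong (_- δ (Q φ′) l) (δ-pull κ φ″ l))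
      ring : ∀ a b c d e f → (a - (b - c) - (d - e)) + (d - (c - f)) ≡ a - b + (e + f)
      ring = solve-∀
      ring′ : ∀ a b c → a - b + (b - c) ≡ a - c
      ring′ = solve-∀

    K-homotopy : ∀ φ l → K (δ φ) l + δ (K φ) l ≡ pull ι φ l
    K-homotopy φ l = begin
      K (δ φ) l + δ (K φ) l
        ≡⟨ cong (λ z → K (δ φ) l + z) (diff (δ-linear l) (pull κ φe) (Q φ)) ⟩
      K (δ φ) l + (δ (pull κ φe) l - δ (Q φ) l)
        ≡⟨ cong (λ z → K (δ φ) l + (z - δ (Q φ) l)) (δ-pull κ φe l) ⟩
      K (δ φ) l + (δ φe (map κ l) - δ (Q φ) l)
        ≡⟨ ring (φ (map κ l)) (δ φe (map κ l)) (Q (δ φ) l) (δ (Q φ) l) ⟩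
      pull κ φ l - (Q (δ φ) l + δ (Q φ) l)
        ≡⟨ cong (λ z → pull κ φ l - z) (Q-homotopy φ l) ⟩
      pull κ φ l - (pull κ φ l - pull ι φ l)
        ≡⟨ ring′ (pull κ φ l) (pull ι φ l) ⟩
      pull ι φ l ∎
      where
      φe = prefix e φ
      ring : ∀ a b c d → (a - b - c) + (b - d) ≡ a - (c + d)
      ring = solve-∀
      ring′ : ∀ a b → a - (a - b) ≡ b
      ring′ = solve-∀

  -- The free poset of signed vectors and explicit chains in it.

  module Signs (r′ : ℕ) where
    r : ℕ
    r = suc r′

    Sign : Set
    Sign = Fin r

    -- The free Z_r-poset of nonzero vectors in (Z_r ∪ {0})ⁿ.
    data E : ℕ → Set where
      pt : ∀ {n} → Sign → E (suc n)
      ι  : ∀ {n} → E n → E (suc n)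
      κ  : ∀ {n} → Sign → E n → E (suc n)

    opaque
      rot : Sign → Sign
      rot i = fromℕ< (ℕ.m%n<n (suc (toℕ i)) r)

      toℕ-rot : ∀ i → toℕ (rot i) ≡ suc (toℕ i) ℕ.% r
      toℕ-rot i = toℕ-fromℕ< _

    toℕ-iter-rot : ∀ k i → toℕ (iter k rot i) ≡ (k ℕ.+ toℕ i) ℕ.% r
    toℕ-iter-rot zero i = sym (ℕ.m<n⇒m%n≡m (toℕ<n i))
    toℕ-iter-rot (suc k) i = begin
      toℕ (iter k rot (rot i))               ≡⟨ toℕ-iter-rot k (rot i) ⟩
      (k ℕ.+ toℕ (rot i)) ℕ.% r              ≡⟨ cong (λ z → (k ℕ.+ z) ℕ.% r) (toℕ-rot i) ⟩
      (k ℕ.+ suc (toℕ i) ℕ.% r) ℕ.% r        ≡⟨ ℕ.%-distribˡ-+ k _ r ⟩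
      (k ℕ.% r ℕ.+ suc (toℕ i) ℕ.% r ℕ.% r) ℕ.% r
                                             ≡⟨ cong (λ z → (k ℕ.% r ℕ.+ z) ℕ.% r) (ℕ.m%n%n≡m%n (suc (toℕ i)) r) ⟩
      (k ℕ.% r ℕ.+ suc (toℕ i) ℕ.% r) ℕ.% r  ≡⟨ ℕ.%-distribˡ-+ k (suc (toℕ i)) r ⟨
      (k ℕ.+ suc (toℕ i)) ℕ.% r              ≡⟨ cong (ℕ._% r) (ℕ.+-suc k (toℕ i)) ⟩
      (suc k ℕ.+ toℕ i) ℕ.% r                ∎

    iter-rot : ∀ i → iter r rot i ≡ i
    iter-rot i = toℕ-injective (begin
      toℕ (iter r rot i)      ≡⟨ toℕ-iter-rot r i ⟩
      (r ℕ.+ toℕ i) ℕ.% r     ≡⟨ cong (ℕ._% r) (ℕ.+-comm r (toℕ i)) ⟩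
      (toℕ i ℕ.+ r) ℕ.% r     ≡⟨ ℕ.[m+n]%n≡m%n (toℕ i) r ⟩
      toℕ i ℕ.% r             ≡⟨ ℕ.m<n⇒m%n≡m (toℕ<n i) ⟩
      toℕ i                   ∎)

    rot-injective : ∀ {i j} → rot i ≡ rot j → i ≡ j
    rot-injective {i} {j} eq = trans (sym (iter-rot i)) (trans (cong (iter r′ rot) eq) (iter-rot j))

    act : ∀ {n} → E n → E n
    act (pt a) = pt (rot a)
    act (ι X) = ι (act X)
    act (κ a X) = κ (rot a) (act X)

    iter-act : ∀ {n} (X : E n) → iter r act X ≡ X
    iter-act (pt {m} a) = trans (iter-pt r a) (cong pt (iter-rot a))
      where iter-pt : ∀ k a → iter k act (pt {m} a) ≡ pt (iter k rot a)
            iter-pt zero a = refl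
            iter-pt (suc k) a = iter-pt k (rot a)
    iter-act {suc m} (ι X) = trans (iter-ι r X) (cong ι (iter-act X))
      where iter-ι : ∀ k (X : E m) → iter k act (ι X) ≡ ι (iter k act X)
            iter-ι zero X = refl
            iter-ι (suc k) X = iter-ι k (act X)
    iter-act {suc m} (κ a X) = trans (iter-κ r a X) (cong₂ κ (iter-rot a) (iter-act X))
      where iter-κ : ∀ k a (X : E m) → iter k act (κ a X) ≡ κ (iter k rot a) (iter k act X)
            iter-κ zero a X = refl
            iter-κ (suc k) a X = iter-κ k (rot a) (act X)

    -- Δ is t − 1 and N is 1 + t + ⋯ + tʳ⁻¹ in the group ring: the differentials
    -- of the standard periodic resolution of Z_r.
    D : ∀ {m} → ℕ → Cochain (E m) → Cochain (E m)
    D zero = Δ act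
    D (suc zero) = N act r
    D (suc (suc n)) = D n

    D-linear : ∀ {m} n (l : List (E m)) → Linear (λ φ → D n φ l)
    D-linear zero = Δ-linear act
    D-linear (suc zero) = N-linear act r
    D-linear (suc (suc n)) = D-linear n

    δ-D : ∀ {m} n φ (l : List (E m)) → δ (D n φ) l ≡ D n (δ φ) l
    δ-D zero = δ-Δ act
    δ-D (suc zero) = δ-N act r
    δ-D (suc (suc n)) = δ-D n

    N-Δ : ∀ {m} φ (l : List (E m)) → N act r (Δ act φ) l ≡ 0ℤ
    N-Δ φ l = begin
      N act r (Δ act φ) l               ≡⟨ N-telescope act r φ l ⟩
      φ (iter r (map act) l) - φ l      ≡⟨ cong (λ l′ → φ l′ - φ l) (iter-map-id r act iter-act l) ⟩
      φ l - φ l                         ≡⟨ ℤ.+-inverseʳ (φ l) ⟩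
      0ℤ                                ∎

    D-D : ∀ {m} n φ (l : List (E m)) → D n (D (suc n) φ) l ≡ 0ℤ
    D-D zero φ l = trans (Δ-N act r φ l) (N-Δ φ l)
    D-D (suc zero) φ l = N-Δ φ l
    D-D (suc (suc n)) = D-D n

    map-ι-act : ∀ {m} (l : List (E m)) → map act (map ι l) ≡ map ι (map act l)
    map-ι-act l = trans (sym (map-∘ l)) (map-∘ l)

    D-pull-ι : ∀ {m} n φ (l : List (E m)) → pull ι (D n φ) l ≡ D n (pull ι φ) l
    D-pull-ι zero φ l = cong (λ l′ → φ l′ - φ (map ι l)) (map-ι-act l)
    D-pull-ι (suc zero) φ l = go r l
      where
      go : ∀ k l → pull ι (N act k φ) l ≡ N act k (pull ι φ) l
      go zero l = refl
      go (suc k) l = cong (λ z → φ (map ι l) + z) (trans (cong (N act k φ) (map-ι-act l)) (go k (map act l)))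
    D-pull-ι (suc (suc n)) = D-pull-ι n

    Kone : ∀ {m} → Cochain (E (suc m)) → Cochain (E m)
    Kone = K ι (κ zero) (pt zero)

    -- The pairing with an n-chain whose boundary is D applied to the (n − 1)-chain.
    c : ∀ n → Cochain (E (suc n)) → ℤ
    c zero φ = φ (pt zero ∷ [])
    c (suc n) φ = c n (D n (Kone φ))

    c-linear : ∀ n → Linear (c n)
    c-linear zero = ev-linear _
    c-linear (suc n) = ∘-linear (c-linear n) (λ l → ∘-linear (D-linear n l) (K-linear ι (κ zero) (pt zero)))

    -- The homotopy replaces `Kone (δ φ)` by `pull ι φ` minus `δ (Kone φ)`. The second term dies by
    -- `c-δ-D`, which in turn follows from this identity one degree lower together with `D-D`.
    c-boundary : ∀ n φ → c (suc n) (δ φ) ≡ c n (D n (pull ι φ))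
    c-δ-D : ∀ n φ → c n (δ (D n (Kone φ))) ≡ 0ℤ

    c-boundary n φ = begin
      c n (D n (Kone (δ φ)))
        ≡⟨ c-linear n .ext (λ l → D-linear n l .ext (λ l′ → shift _ _ _ (K-homotopy ι (κ zero) (pt zero) φ l′))) ⟩
      c n (D n (λ l → pull ι φ l - δ (Kone φ) l))
        ≡⟨ c-linear n .ext (λ l → trans (diff (D-linear n l) (pull ι φ) (δ (Kone φ))) (cong (λ z → D n (pull ι φ) l - z) (sym (δ-D n (Kone φ) l)))) ⟩
      c n (λ l → D n (pull ι φ) l - δ (D n (Kone φ)) l)
        ≡⟨ diff (c-linear n) (D n (pull ι φ)) (δ (D n (Kone φ))) ⟩
      c n (D n (pull ι φ)) - c n (δ (D n (Kone φ)))
        ≡⟨ cong (λ z → c n (D n (pull ι φ)) - z) (c-δ-D n φ) ⟩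
      c n (D n (pull ι φ)) - 0ℤ
        ≡⟨ ℤ.+-identityʳ _ ⟩
      c n (D n (pull ι φ)) ∎
      where
      shift : ∀ x y z → x + y ≡ z → x ≡ z - y
      shift x y z eq = trans (ring x y) (cong (_- y) eq)
        where ring : ∀ x y → x ≡ x + y - y
              ring = solve-∀

    -- The coboundary at a single vertex is the value at the empty list, which `act` fixes, so `Δ`
    -- gives 0 there.
    c-δ-D zero φ = trans (ℤ.+-identityʳ _) (ℤ.+-inverseʳ (Kone φ []))
    c-δ-D (suc n) φ = begin
      c (suc n) (δ (D (suc n) (Kone φ)))      ≡⟨ c-boundary n (D (suc n) (Kone φ)) ⟩
      c n (D n (pull ι (D (suc n) (Kone φ))))
        ≡⟨ c-linear n .ext (λ l → trans (D-linear n l .ext (D-pull-ι (suc n) (Kone φ))) (D-D n _ l)) ⟩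
      c n (λ _ → 0ℤ)                          ≡⟨ vanish (c-linear n) ⟩
      0ℤ                                      ∎

    -- Integral cocycles of Z_r and their values on the explicit chains.

    wrapℕ : ℕ → ℕ → ℤ
    wrapℕ x y = if y ℕ.<ᵇ x then 1ℤ else 0ℤ

    wrapℕ-< : ∀ {x y} → y ℕ.< x → wrapℕ x y ≡ 1ℤ
    wrapℕ-< {x} {y} lt with y ℕ.<ᵇ x | ℕ.<⇒<ᵇ lt
    ... | true | _ = refl

    wrapℕ-≤ : ∀ {x y} → x ℕ.≤ y → wrapℕ x y ≡ 0ℤ
    wrapℕ-≤ {x} {y} le with y ℕ.<ᵇ x in eq
    ... | false = refl
    ... | true  = ⊥-elim (ℕ.≤⇒≯ le (ℕ.<ᵇ⇒< y x (subst T (sym eq) tt)))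

    wrap : Sign → Sign → ℤ
    wrap a b = wrapℕ (toℕ a) (toℕ b)

    top : Sign → ℤ
    top a = wrapℕ (suc (toℕ a)) r′

    lift : Sign → ℤ
    lift a = + toℕ a

    data Rot (a : Sign) : Set where
      turn : toℕ a ≡ r′ → toℕ (rot a) ≡ 0 → Rot a
      step : toℕ a ℕ.< r′ → toℕ (rot a) ≡ suc (toℕ a) → Rot a

    rot-view : ∀ a → Rot a
    rot-view a with toℕ a ℕ.≟ r′
    ... | yes eq = turn eq (trans (toℕ-rot a) (trans (cong (λ z → suc z ℕ.% r) eq) (ℕ.n%n≡0 r)))
    ... | no ne = step a<r′ (trans (toℕ-rot a) (ℕ.m<n⇒m%n≡m (ℕ.s≤s a<r′)))
      where a<r′ = ℕ.≤∧≢⇒< (ℕ.s≤s⁻¹ (toℕ<n a)) ne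

    top-turn : ∀ {a} → toℕ a ≡ r′ → top a ≡ 1ℤ
    top-turn eq = wrapℕ-< (ℕ.s≤s (ℕ.≤-reflexive (sym eq)))

    top-step : ∀ {a} → toℕ a ℕ.< r′ → top a ≡ 0ℤ
    top-step = wrapℕ-≤

    sum₃ : ∀ {x x′ y y′ z z′} → x ≡ x′ → y ≡ y′ → z ≡ z′ → x + y - z ≡ x′ + y′ - z′
    sum₃ p q e = cong₂ _-_ (cong₂ _+_ p q) e

    -- `wrap` marks descents, and rotation moves only the last sign past the others. So it changes
    -- `wrap` by the coboundary of `top`, the indicator of that sign.
    wrap-rot : ∀ a b → wrap (rot a) (rot b) ≡ wrap a b + top b - top a
    wrap-rot a b with rot-view a | rot-view b
    ... | turn p q | turn p′ q′ = trans (cong₂ wrapℕ q q′)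
      (sym (sum₃ (wrapℕ-≤ (ℕ.≤-reflexive (trans p (sym p′)))) (top-turn {b} p′) (top-turn {a} p)))
    ... | turn p q | step p′ q′ = trans (cong₂ wrapℕ q q′)
      (sym (sum₃ (wrapℕ-< (subst (toℕ b ℕ.<_) (sym p) p′)) (top-step {b} p′) (top-turn {a} p)))
    ... | step p q | turn p′ q′ = trans (cong₂ wrapℕ q q′)
      (sym (sum₃ (wrapℕ-≤ (ℕ.<⇒≤ (subst (toℕ a ℕ.<_) (sym p′) p))) (top-turn {b} p′) (top-step {a} p)))
    ... | step p q | step p′ q′ = trans (cong₂ wrapℕ q q′)
      (trans (ring (wrap a b)) (sym (sum₃ {x = wrap a b} refl (top-step {b} p′) (top-step {a} p))))
      where ring : ∀ x → x ≡ x + 0ℤ - 0ℤ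
            ring = solve-∀

    lift-rot : ∀ a → lift (rot a) ≡ lift a + 1ℤ - + r * top a
    lift-rot a with rot-view a
    ... | turn p q = trans (cong +_ q) (trans (ring (+ r′))
        (sym (cong₂ (λ x y → x + 1ℤ - + r * y) (cong +_ p) (top-turn {a} p))))
      where ring : ∀ x → 0ℤ ≡ x + 1ℤ - (1ℤ + x) * 1ℤ
            ring = solve-∀
    ... | step p q = trans (cong +_ q) (trans (ring (lift a) (+ r))
        (sym (cong (λ y → lift a + 1ℤ - + r * y) (top-step {a} p))))
      where ring : ∀ x y → 1ℤ + x ≡ x + 1ℤ - y * 0ℤ
            ring = solve-∀

    -- The number of rotations, between 0 and r - 1, that lead from a to b. The gaps from x to y and
    -- from y to z add up to the gap from x to z plus r times `carry x y z`, so `carry` is the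
    -- Bockstein 2-cocycle.
    gap : Sign → Sign → ℤ
    gap a b = lift b - lift a + + r * wrap a b

    carry : Sign → Sign → Sign → ℤ
    carry x y z = wrap x y + wrap y z - wrap x z

    gap-rot : ∀ x y → gap (rot x) (rot y) ≡ gap x y
    gap-rot x y =
      trans (cong₂ _+_ (cong₂ _-_ (lift-rot y) (lift-rot x)) (cong (+ r *_) (wrap-rot x y))) (ring (lift x) (lift y) (top x) (top y) (wrap x y) (+ r))
      where ring : ∀ x y a b w r → y + 1ℤ - r * b - (x + 1ℤ - r * a) + r * (w + b - a) ≡ y - x + r * w
            ring = solve-∀

    carry-rot : ∀ x y z → carry (rot x) (rot y) (rot z) ≡ carry x y z
    carry-rot x y z = trans (sum₃ (wrap-rot x y) (wrap-rot y z) (wrap-rot x z))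
      (ring (top x) (top y) (top z) (wrap x y) (wrap y z) (wrap x z))
      where ring : ∀ a b c u v w → (u + b - a) + (v + c - b) - (w + c - a) ≡ u + v - w
            ring = solve-∀

    wrap-refl : ∀ x → wrap x x ≡ 0ℤ
    wrap-refl x = wrapℕ-≤ (ℕ.≤-refl {toℕ x})

    gap-refl : ∀ x → gap x x ≡ 0ℤ
    gap-refl x = trans (cong (λ w → lift x - lift x + + r * w) (wrap-refl x)) (ring (lift x) (+ r))
      where ring : ∀ x r → x - x + r * 0ℤ ≡ 0ℤ
            ring = solve-∀

    carry-reflˡ : ∀ x z → carry x x z ≡ 0ℤ
    carry-reflˡ x z = trans (cong (λ w → w + wrap x z - wrap x z) (wrap-refl x)) (ring (wrap x z))
      where ring : ∀ w → 0ℤ + w - w ≡ 0ℤ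
            ring = solve-∀

    carry-reflʳ : ∀ x z → carry x z z ≡ 0ℤ
    carry-reflʳ x z = trans (cong (λ w → wrap x z + w - wrap x z) (wrap-refl z)) (ring (wrap x z))
      where ring : ∀ w → w + 0ℤ - w ≡ 0ℤ
            ring = solve-∀

    -- Cocycles generating the cohomology of Z_r in even and in odd degrees; the value of
    -- odd at [] makes δ odd = r · even hold in degree 0 too.
    even odd : Cochain Sign
    even [] = 0ℤ
    even (x ∷ []) = 1ℤ
    even (x ∷ y ∷ []) = 0ℤ
    even (x ∷ y ∷ z ∷ l) = carry x y z * even (z ∷ l)
    odd [] = + r
    odd (x ∷ []) = 0ℤ
    odd (x ∷ y ∷ l) = gap x y * even (y ∷ l)

    prefix-even : ∀ x l → δ even (x ∷ l) ≡ 0ℤ → δ (prefix x even) l ≡ even l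
    prefix-even x l eq = begin
      δ (prefix x even) l            ≡⟨ ring (even l) _ ⟩
      even l - δ even (x ∷ l)        ≡⟨ cong (λ s → even l - s) eq ⟩
      even l - 0ℤ                    ≡⟨ ℤ.+-identityʳ (even l) ⟩
      even l                         ∎
      where ring : ∀ e d → d ≡ e - (e - d)
            ring = solve-∀

    δ-even : ∀ l → δ even l ≡ 0ℤ
    δ-even [] = refl
    δ-even (x ∷ []) = refl
    δ-even (x ∷ y ∷ []) = refl
    δ-even (x ∷ y ∷ z ∷ []) = refl
    δ-even (x ∷ y ∷ z ∷ l@(v ∷ _)) = begin
      carry y z v * e - (carry x z v * e - (carry x y v * e - δ (λ l′ → carry x y z * even (z ∷ l′)) l))
        ≡⟨ cong (λ s → carry y z v * e - (carry x z v * e - (carry x y v * e - s)))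
             (trans (scale (δ-linear l) (carry x y z) (prefix z even)) (cong (carry x y z *_) (prefix-even z l (δ-even (z ∷ l))))) ⟩
      carry y z v * e - (carry x z v * e - (carry x y v * e - carry x y z * e))
        ≡⟨ ring (wrap x y) (wrap x z) (wrap x v) (wrap y z) (wrap y v) (wrap z v) e ⟩
      0ℤ ∎
      where
      e = even l
      ring : ∀ xy xz xv yz yv zv e → (yz + zv - yv) * e - ((xz + zv - xv) * e - ((xy + yv - xv) * e - (xy + yz - xz) * e)) ≡ 0ℤ
      ring = solve-∀
    δ-even-tail : ∀ x l → δ (prefix x even) l ≡ even l
    δ-even-tail x l = prefix-even x l (δ-even (x ∷ l))

    δ-odd : ∀ l → δ odd l ≡ + r * even l
    δ-odd [] = sym (ℤ.*-zeroʳ (+ r))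
    δ-odd (x ∷ []) = trans (ℤ.+-identityʳ (+ r)) (sym (ℤ.*-identityʳ (+ r)))
    δ-odd (x ∷ y ∷ []) = sym (ℤ.*-zeroʳ (+ r))
    δ-odd (x ∷ y ∷ l@(z ∷ _)) = begin
      gap y z * e - (gap x z * e - δ (λ l′ → gap x y * even (y ∷ l′)) l)
        ≡⟨ cong (λ s → gap y z * e - (gap x z * e - s))
             (trans (scale (δ-linear l) (gap x y) (prefix y even)) (cong (gap x y *_) (δ-even-tail y l))) ⟩
      gap y z * e - (gap x z * e - gap x y * e)
        ≡⟨ ring (lift x) (lift y) (lift z) (wrap x y) (wrap y z) (wrap x z) (+ r) e ⟩
      + r * (carry x y z * e) ∎
      where
      e = even l
      ring : ∀ x y z u v w r e → (z - y + r * v) * e - ((z - x + r * w) * e - (y - x + r * u) * e) ≡ r * ((u + v - w) * e)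
      ring = solve-∀

    -- Cup products of `lift` and `wrap` with `even`. Modulo r, `odd` is the coboundary of
    -- `lift∪even`, which is not invariant. The value 1 at the empty list matches `odd [] = + r`.
    lift∪even wrap∪even : Cochain Sign
    lift∪even [] = 0ℤ
    lift∪even (x ∷ l) = lift x * even (x ∷ l)
    wrap∪even [] = 1ℤ
    wrap∪even (x ∷ []) = 0ℤ
    wrap∪even (x ∷ y ∷ l) = wrap x y * even (y ∷ l)

    odd-mod : ∀ l → odd l ≡ δ lift∪even l + + r * wrap∪even l
    odd-mod [] = ring (+ r)
      where ring : ∀ r → r ≡ 0ℤ + r * 1ℤ
            ring = solve-∀
    odd-mod (x ∷ []) = ring (+ r)
      where ring : ∀ r → 0ℤ ≡ 0ℤ + r * 0ℤ
            ring = solve-∀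
    odd-mod (x ∷ l@(y ∷ l′)) = begin
      gap x y * e
        ≡⟨ ring (lift x) (lift y) (wrap x y) (+ r) e ⟩
      (lift y * e - lift x * e) + + r * (wrap x y * e)
        ≡⟨ cong (λ s → (lift y * e - s) + + r * (wrap x y * e))
             (trans (scale (δ-linear l) (lift x) (prefix x even)) (cong (lift x *_) (δ-even-tail x l))) ⟨
      δ lift∪even (x ∷ l) + + r * (wrap x y * e) ∎
      where
      e = even l
      ring : ∀ x y w r e → (y - x + r * w) * e ≡ (y * e - x * e) + r * (w * e)
      ring = solve-∀

    even-rot : ∀ l → even (map rot l) ≡ even l
    even-rot [] = refl
    even-rot (x ∷ []) = refl
    even-rot (x ∷ y ∷ []) = refl
    even-rot (x ∷ y ∷ z ∷ l) = cong₂ _*_ (carry-rot x y z) (even-rot (z ∷ l))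

    odd-rot : ∀ l → odd (map rot l) ≡ odd l
    odd-rot [] = refl
    odd-rot (x ∷ []) = refl
    odd-rot (x ∷ y ∷ l) = cong₂ _*_ (gap-rot x y) (even-rot (y ∷ l))

    top∪even : Cochain Sign
    top∪even [] = 0ℤ
    top∪even (x ∷ l) = top x * even (x ∷ l)

    -- Rotation adds 1 to `lift`, except at the last sign, where it adds 1 - r. Hence `Δ` turns
    -- `lift∪even` into `even` modulo r.
    lift∪even-rot : ∀ l → lift∪even (map rot l) - lift∪even l ≡ even l + ℤ.- (+ r) * top∪even l
    lift∪even-rot [] = ring (+ r)
      where ring : ∀ r → 0ℤ ≡ 0ℤ + ℤ.- r * 0ℤ
            ring = solve-∀
    lift∪even-rot (x ∷ l) = trans (cong (_- lift∪even (x ∷ l)) (cong₂ _*_ (lift-rot x) (even-rot (x ∷ l))))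
      (ring (lift x) (top x) (+ r) (even (x ∷ l)))
      where ring : ∀ x t r e → (x + 1ℤ - r * t) * e - x * e ≡ e + ℤ.- r * (t * e)
            ring = solve-∀

    Equivariant : ∀ {n} → (E n → Sign) → Set
    Equivariant s = ∀ X → s (act X) ≡ rot (s X)

    map-equivariant : ∀ {n} {s : E n → Sign} → Equivariant s → ∀ l → map s (map act l) ≡ map rot (map s l)
    map-equivariant eqv l = trans (sym (map-∘ l)) (trans (map-cong eqv l) (map-∘ l))

    1-mod-r : ℤ → Set
    1-mod-r x = ∃ λ z → x ≡ 1ℤ + + r * z

    double : ℕ → ℕ
    double zero = zero
    double (suc i) = suc (suc (double i))

    D-even : ∀ {m} i (φ : Cochain (E m)) l → D (double i) φ l ≡ Δ act φ l
    D-even zero φ l = refl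
    D-even (suc i) φ l = D-even i φ l

    D-odd : ∀ {m} i (φ : Cochain (E m)) l → D (suc (double i)) φ l ≡ N act r φ l
    D-odd zero φ l = refl
    D-odd (suc i) φ l = D-odd i φ l

    -- Descent in the degree. For even degrees, `r * even` is the coboundary of `odd`, so one gets
    -- the norm of `odd` one degree lower; `odd` is invariant, the norm is multiplication by r, and
    -- r cancels over the integers. For odd degrees, `odd` is the coboundary of `lift∪even` modulo
    -- r, which leaves `Δ` of `lift∪even`, that is, `even` one degree lower.
    c-even : ∀ i {s : E (suc (double i)) → Sign} → Equivariant s → 1-mod-r (c (double i) (pull s even))
    c-odd : ∀ i {s : E (suc (suc (double i))) → Sign} → Equivariant s → 1-mod-r (c (suc (double i)) (pull s odd))

    c-even zero eqv = 0ℤ , ring (+ r)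
      where ring : ∀ r → 1ℤ ≡ 1ℤ + r * 0ℤ
            ring = solve-∀
    c-even (suc i) {s} eqv with c-odd i {s ∘ ι} (eqv ∘ ι)
    ... | z , eq = z , trans (ℤ.*-cancelˡ-≡ (+ r) _ _ r*c) eq
      where
      n = suc (double i)
      s′ = s ∘ ι
      r*c : + r * c (suc n) (pull s even) ≡ + r * c n (pull s′ odd)
      r*c = begin
        + r * c (suc n) (pull s even)
          ≡⟨ scale (c-linear (suc n)) (+ r) (pull s even) ⟨
        c (suc n) (λ l → + r * pull s even l)
          ≡⟨ c-linear (suc n) .ext (λ l → trans (δ-pull s odd l) (δ-odd (map s l))) ⟨
        c (suc n) (δ (pull s odd))
          ≡⟨ c-boundary n (pull s odd) ⟩
        c n (D n (pull ι (pull s odd)))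
          ≡⟨ c-linear n .ext (λ l → trans (D-odd i _ l) (N-linear act r l .ext (λ l′ → cong odd (sym (map-∘ l′))))) ⟩
        c n (N act r (pull s′ odd))
          ≡⟨ c-linear n .ext (λ l → N-invariant act r (pull s′ odd)
               (λ l → trans (cong odd (map-equivariant {s = s′} (eqv ∘ ι) l)) (odd-rot (map s′ l))) l) ⟩
        c n (λ l → + r * pull s′ odd l)
          ≡⟨ scale (c-linear n) (+ r) (pull s′ odd) ⟩
        + r * c n (pull s′ odd) ∎

    c-odd i {s} eqv with c-even i {s ∘ ι} (eqv ∘ ι)
    ... | z , eq = z - x + y , (begin
        c (suc n) (pull s odd)
          ≡⟨ c-linear (suc n) .ext (λ l → trans (odd-mod (map s l)) (cong₂ _+_ (trans (sym (δ-pull s lift∪even l)) (sym (ℤ.*-identityˡ _))) refl)) ⟩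
        c (suc n) (λ l → 1ℤ * δ (pull s lift∪even) l + + r * pull s wrap∪even l)
          ≡⟨ c-linear (suc n) .linear 1ℤ (+ r) (δ (pull s lift∪even)) (pull s wrap∪even) ⟩
        1ℤ * c (suc n) (δ (pull s lift∪even)) + + r * y
          ≡⟨ cong (λ w → 1ℤ * w + + r * y) boundary ⟩
        1ℤ * (1ℤ * c n (pull s′ even) + ℤ.- (+ r) * x) + + r * y
          ≡⟨ cong (λ w → 1ℤ * (1ℤ * w + ℤ.- (+ r) * x) + + r * y) eq ⟩
        1ℤ * (1ℤ * (1ℤ + + r * z) + ℤ.- (+ r) * x) + + r * y
          ≡⟨ ring (+ r) x y z ⟩
        1ℤ + + r * (z - x + y) ∎)
      where
      n = double i
      s′ = s ∘ ι
      x = c n (pull s′ top∪even)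
      y = c (suc n) (pull s wrap∪even)
      ring : ∀ r x y z → 1ℤ * (1ℤ * (1ℤ + r * z) + ℤ.- r * x) + r * y ≡ 1ℤ + r * (z - x + y)
      ring = solve-∀
      boundary : c (suc n) (δ (pull s lift∪even)) ≡ 1ℤ * c n (pull s′ even) + ℤ.- (+ r) * x
      boundary = begin
        c (suc n) (δ (pull s lift∪even))
          ≡⟨ c-boundary n (pull s lift∪even) ⟩
        c n (D n (pull ι (pull s lift∪even)))
          ≡⟨ c-linear n .ext (λ l → trans (D-even i _ l) (Δ-linear act l .ext (λ l′ → cong lift∪even (sym (map-∘ l′))))) ⟩
        c n (Δ act (pull s′ lift∪even))
          ≡⟨ c-linear n .ext (λ l → trans (cong (λ l′ → lift∪even l′ - lift∪even (map s′ l)) (map-equivariant {s = s′} (eqv ∘ ι) l))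
               (trans (lift∪even-rot (map s′ l)) (cong (_+ ℤ.- (+ r) * top∪even (map s′ l)) (sym (ℤ.*-identityˡ (even (map s′ l))))))) ⟩
        c n (λ l → 1ℤ * pull s′ even l + ℤ.- (+ r) * pull s′ top∪even l)
          ≡⟨ c-linear n .linear 1ℤ (ℤ.- (+ r)) (pull s′ even) (pull s′ top∪even) ⟩
        1ℤ * c n (pull s′ even) + ℤ.- (+ r) * x ∎

    -- The order on signed vectors and the Tucker lemma.

    infix 4 _⊑_
    -- Going up may replace zeros by signs but never changes a sign. Here `pt a` is (a, 0, ..., 0),
    -- while `ι` and `κ a` put 0 and a in front.
    data _⊑_ : ∀ {n} → E n → E n → Set where
      pt⊑pt : ∀ {n a} → pt {n} a ⊑ pt a
      pt⊑κ  : ∀ {n a} {X : E n} → pt a ⊑ κ a X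
      ι⊑ι   : ∀ {n} {X Y : E n} → X ⊑ Y → ι X ⊑ ι Y
      ι⊑κ   : ∀ {n a} {X Y : E n} → X ⊑ Y → ι X ⊑ κ a Y
      κ⊑κ   : ∀ {n a} {X Y : E n} → X ⊑ Y → κ a X ⊑ κ a Y

    ⊑-refl : ∀ {n} {X : E n} → X ⊑ X
    ⊑-refl {X = pt a} = pt⊑pt
    ⊑-refl {X = ι X} = ι⊑ι ⊑-refl
    ⊑-refl {X = κ a X} = κ⊑κ ⊑-refl

    act-⊑ : ∀ {n} {X Y : E n} → X ⊑ Y → act X ⊑ act Y
    act-⊑ pt⊑pt = pt⊑pt
    act-⊑ pt⊑κ = pt⊑κ
    act-⊑ (ι⊑ι p) = ι⊑ι (act-⊑ p)
    act-⊑ (ι⊑κ p) = ι⊑κ (act-⊑ p)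
    act-⊑ (κ⊑κ p) = κ⊑κ (act-⊑ p)

    Chain : ∀ {n} → List (E n) → Set
    Chain = Linked _⊑_

    map-chain : ∀ {m n} {f : E m → E n} → (∀ {X Y} → X ⊑ Y → f X ⊑ f Y) → ∀ {l} → Chain l → Chain (map f l)
    map-chain mono ch = Linked.map⁺ (Linked.map mono ch)

    VanishesOnChains : ∀ {n} → ℕ → Cochain (E n) → Set
    VanishesOnChains k φ = ∀ l → Chain l → length l ≡ k → φ l ≡ 0ℤ

    -- The prism over a chain consists of chains: it follows `ι` up to some vector X, passes from
    -- `ι X` to `κ zero X`, and goes on along `κ zero`. The cone adds `pt zero` below a chain of
    -- `κ zero`. Hence `c n` evaluates cochains only on chains of the poset.
    Q-vanishes : ∀ {m} k (φ : Cochain (E (suc m))) X l → Chain (X ∷ l) → length l ≡ k →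
      (∀ l′ → Chain (ι X ∷ l′) → length l′ ≡ suc k → φ (ι X ∷ l′) ≡ 0ℤ) → Q ι (κ zero) (pt zero) φ (X ∷ l) ≡ 0ℤ
    Q-vanishes k φ X l ch len van = cong₂ _-_
      (van _ (ι⊑κ ⊑-refl ∷ map-chain κ⊑κ ch) (cong suc (trans (length-map (κ zero) l) len)))
      (tail l ch len)
      where
      tail : ∀ l → Chain (X ∷ l) → length l ≡ k → Q ι (κ zero) (pt zero) (prefix (ι X) φ) l ≡ 0ℤ
      tail [] _ _ = refl
      tail (Y ∷ l) (X⊑Y ∷ ch) refl = Q-vanishes _ (prefix (ι X) φ) Y l ch refl
        (λ l′ ch′ len′ → van _ (ι⊑ι X⊑Y ∷ ch′) (cong suc len′))

    Kone-vanishes : ∀ {m} k (φ : Cochain (E (suc m))) →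
      VanishesOnChains (suc (suc k)) φ → VanishesOnChains (suc k) (Kone φ)
    Kone-vanishes k φ van (X ∷ l) ch refl = cong₂ _-_
      (van _ (pt⊑κ ∷ map-chain κ⊑κ ch) (cong suc (length-map (κ zero) (X ∷ l))))
      (Q-vanishes _ φ X l ch refl (λ l′ ch′ len → van _ ch′ (cong suc len)))

    D-vanishes : ∀ {m} n k (φ : Cochain (E m)) → VanishesOnChains k φ → VanishesOnChains k (D n φ)
    D-vanishes zero k φ van l ch len =
      cong₂ _-_ (van _ (map-chain act-⊑ ch) (trans (length-map act l) len)) (van l ch len)
    D-vanishes (suc zero) k φ van = go r
      where
      go : ∀ j l → Chain l → length l ≡ k → N act j φ l ≡ 0ℤ
      go zero l ch len = refl
      go (suc j) l ch len = cong₂ _+_ (van l ch len) (go j _ (map-chain act-⊑ ch) (trans (length-map act l) len))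
    D-vanishes (suc (suc n)) = D-vanishes n

    c-vanishes : ∀ n φ → VanishesOnChains (suc n) φ → c n φ ≡ 0ℤ
    c-vanishes zero φ van = van _ [-] refl
    c-vanishes (suc n) φ van = c-vanishes n _ (D-vanishes n _ _ (Kone-vanishes n φ van))

    data Repeat : List Sign → Set where
      here  : ∀ {x l} → Repeat (x ∷ x ∷ l)
      there : ∀ {x l} → Repeat l → Repeat (x ∷ l)

    -- The cocycles are normalised: a gap from a sign to itself is 0, and a carry with two equal
    -- neighbours is 0.
    even-repeat : ∀ {l} → Repeat l → even l ≡ 0ℤ
    even-repeat {x ∷ x ∷ []} here = refl
    even-repeat {x ∷ x ∷ z ∷ l} here = cong (_* even (z ∷ l)) (carry-reflˡ x z)
    even-repeat {x ∷ []} (there ())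
    even-repeat {x ∷ y ∷ []} (there rep) = refl
    even-repeat {x ∷ y ∷ z ∷ l} (there here) = cong (_* even (z ∷ l)) (carry-reflʳ x z)
    even-repeat {x ∷ y ∷ z ∷ l} (there (there rep)) =
      trans (cong (carry x y z *_) (even-repeat rep)) (ℤ.*-zeroʳ (carry x y z))

    odd-repeat : ∀ {l} → Repeat l → odd l ≡ 0ℤ
    odd-repeat {x ∷ x ∷ l} here = cong (_* even (x ∷ l)) (gap-refl x)
    odd-repeat {x ∷ []} (there ())
    odd-repeat {x ∷ y ∷ l} (there rep) = trans (cong (gap x y *_) (even-repeat rep)) (ℤ.*-zeroʳ (gap x y))

    parity : ∀ n → ∃ λ i → (n ≡ double i) ⊎ (n ≡ suc (double i))
    parity zero = 0 , inj₁ refl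
    parity (suc n) with parity n
    ... | i , inj₁ eq = i , inj₂ (cong suc eq)
    ... | i , inj₂ eq = suc i , inj₁ (cong suc eq)

    0≢1-mod-r : 2 ℕ.≤ r → ¬ 1-mod-r 0ℤ
    0≢1-mod-r r≥2 (z , eq) = ℕ.<⇒≢ r≥2 (sym (ℕ.m*n≡1⇒m≡1 r ℤ.∣ z ∣ (begin
        r ℕ.* ℤ.∣ z ∣        ≡⟨ ℤ.abs-* (+ r) z ⟨
        ℤ.∣ + r * z ∣        ≡⟨ cong ℤ.∣_∣ (trans (ring (+ r * z)) (cong (_- 1ℤ) (sym eq))) ⟩
        1                    ∎)))
      where ring : ∀ x → x ≡ 1ℤ + x - 1ℤ
            ring = solve-∀

    -- Repeats everywhere would make the pulled-back cocycle of degree n vanish on all chains, so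
    -- its pairing with `c n` would be 0. That pairing is 1 modulo r.
    no-repetitive-sign : 2 ℕ.≤ r → ∀ n (s : E (suc n) → Sign) → Equivariant s →
      ¬ (∀ l → Chain l → length l ≡ suc n → Repeat (map s l))
    no-repetitive-sign r≥2 n s eqv rep with parity n
    ... | i , inj₁ refl = 0≢1-mod-r r≥2 (subst 1-mod-r
          (c-vanishes (double i) (pull s even) (λ l ch len → even-repeat (rep l ch len))) (c-even i eqv))
    ... | i , inj₂ refl = 0≢1-mod-r r≥2 (subst 1-mod-r
          (c-vanishes (suc (double i)) (pull s odd) (λ l ch len → odd-repeat (rep l ch len))) (c-odd i eqv))

    -- A chain with more members than there are levels stays on some level for a step.
    no-levels : 2 ℕ.≤ r → ∀ n (s : E (suc n) → Sign) → Equivariant s → (L : E (suc n) → ℕ) →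
      (∀ X → 1 ℕ.≤ L X) → (∀ X → L X ℕ.≤ n) →
      (∀ {X Y} → X ⊑ Y → L X ℕ.≤ L Y) → (∀ {X Y} → X ⊑ Y → L X ≡ L Y → s X ≡ s Y) → ⊥
    no-levels r≥2 n s eqv L L≥1 L≤n mono same = no-repetitive-sign r≥2 n s eqv rep
      where
      climb : ∀ X l → Chain (X ∷ l) → Repeat (map s (X ∷ l)) ⊎ (length l ℕ.+ L X ℕ.≤ n)
      climb X [] _ = inj₂ (L≤n X)
      climb X (Y ∷ l) (X⊑Y ∷ ch) with climb Y l ch
      ... | inj₁ rep = inj₁ (there rep)
      ... | inj₂ le with ℕ.m≤n⇒m<n∨m≡n (mono X⊑Y)
      ...   | inj₁ lt = inj₂ (ℕ.≤-trans (ℕ.≤-reflexive (sym (ℕ.+-suc (length l) (L X))))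
                                (ℕ.≤-trans (ℕ.+-monoʳ-≤ (length l) lt) le))
      ...   | inj₂ eq = inj₁ (subst (λ a → Repeat (s X ∷ a ∷ map s l)) (same X⊑Y eq) here)

      rep : ∀ l → Chain l → length l ≡ suc n → Repeat (map s l)
      rep (X ∷ l) ch len with climb X l ch
      ... | inj₁ rep = rep
      ... | inj₂ le = ⊥-elim (ℕ.<⇒≢ (ℕ.≤-trans (ℕ.≤-reflexive (ℕ.+-comm 1 (length l)))
              (ℕ.≤-trans (ℕ.+-monoʳ-≤ (length l) (L≥1 X)) le)) (ℕ.suc-injective len))

-- Finite counting, and equivariant signs of rows modulo a prime.

module Counting where
  open ZrTucker
  open import Data.Nat
  open import Data.Nat.Properties
  open import Data.Nat.DivMod
  open import Data.Nat.Primality using (Prime)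
  open import Data.Nat.Coprimality using (prime⇒coprime; coprime-Bézout)
  open import Data.Nat.GCD using (module Bézout)
  open import Data.Nat.Tactic.RingSolver using (solve-∀)
  open import Algebra.Properties.Semiring.Sum +-*-semiring
    using (sum; sum-cong-≗; ∑-comm; ∑-distrib-+; sum-permute; *-distribˡ-sum)
  open import Data.Fin as Fin using (Fin; zero; suc; toℕ; fromℕ<)
  open import Data.Fin.Properties as Fin using (toℕ-fromℕ<; toℕ-injective)
  open import Data.Fin.Subset using (Subset; _∈_; ∣_∣; ⊥; inside; outside)
  open import Data.Fin.Subset.Properties using (∉⊥; ∣⊥∣≡0)
  open import Data.Vec as Vec using (_∷_; here; there)
  open import Data.Bool using (Bool; true; false; T)
  open import Data.Maybe as Maybe using (Maybe; just; nothing)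
  open import Data.Empty using (⊥-elim)
  open import Data.Unit using (tt)
  open import Data.Product
  open import Function
  open import Function.Definitions using (Injective)
  open import Relation.Nullary
  open import Relation.Nullary.Decidable using (⌊_⌋; toWitness; fromWitness)
  open import Relation.Binary.PropositionalEquality
  open ≡-Reasoning

  private variable
    n d k : ℕ

  witness : {P : Set} (P? : Dec P) → T ⌊ P? ⌋ → P
  witness P? = toWitness {a? = P?}

  holds : {P : Set} (P? : Dec P) → P → T ⌊ P? ⌋
  holds P? = fromWitness {a? = P?}

  T-ext : ∀ {a b} → (T a → T b) → (T b → T a) → a ≡ b
  T-ext {false} {false} f g = refl
  T-ext {false} {true}  f g = ⊥-elim (g tt)
  T-ext {true}  {false} f g = ⊥-elim (f tt)
  T-ext {true}  {true}  f g = refl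

  sum-mono : {f g : Fin n → ℕ} → (∀ i → f i ≤ g i) → sum f ≤ sum g
  sum-mono {zero} le = z≤n
  sum-mono {suc n} le = +-mono-≤ (le zero) (sum-mono (le ∘ suc))

  sum-squeeze : {f g : Fin n → ℕ} → (∀ i → f i ≤ g i) → sum f ≡ sum g → ∀ i → f i ≡ g i
  sum-squeeze {suc n} {f} {g} le eq = λ { zero → f₀≡g₀ ; (suc i) → sum-squeeze (le ∘ suc) tails i }
    where
    f₀≡g₀ : f zero ≡ g zero
    f₀≡g₀ = ≤-antisym (le zero) (+-cancelʳ-≤ (sum (f ∘ suc)) (g zero) (f zero)
      (≤-trans (+-monoʳ-≤ (g zero) (sum-mono (le ∘ suc))) (≤-reflexive (sym eq))))
    tails : sum (f ∘ suc) ≡ sum (g ∘ suc)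
    tails = +-cancelˡ-≡ (f zero) _ _ (trans eq (cong (_+ sum (g ∘ suc)) (sym f₀≡g₀)))

  sum-pigeonhole : {g : Fin n → ℕ} → n * k < sum g → ∃ λ i → k < g i
  sum-pigeonhole {suc n} {k} {g} lt with k <? g zero
  ... | yes k<g = zero , k<g
  ... | no k≮g with sum-pigeonhole {n} {k} (+-cancelˡ-< k _ _ (≤-trans lt (+-monoˡ-≤ (sum (g ∘ suc)) (≮⇒≥ k≮g))))
  ...   | i , k<g = suc i , k<g

  term≤sum : (f : Fin n → ℕ) → ∀ i → f i ≤ sum f
  term≤sum f zero = m≤m+n _ _
  term≤sum f (suc i) = ≤-trans (term≤sum (f ∘ suc) i) (m≤n+m _ _)

  sum≤ : {f : Fin n → ℕ} → (∀ i → f i ≤ k) → sum f ≤ n * k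
  sum≤ {zero} le = z≤n
  sum≤ {suc n} le = +-mono-≤ (le zero) (sum≤ (le ∘ suc))

  bit : Bool → ℕ
  bit true = 1
  bit false = 0

  bit-mono : ∀ {a b} → (T a → T b) → bit a ≤ bit b
  bit-mono {false} _ = z≤n
  bit-mono {true} {true} _ = s≤s z≤n
  bit-mono {true} {false} f = ⊥-elim (f tt)

  bit-injective : ∀ {a b} → bit a ≡ bit b → a ≡ b
  bit-injective {false} {false} _ = refl
  bit-injective {true}  {true}  _ = refl

  bit-T : ∀ {a} → T a → bit a ≡ 1
  bit-T {true} _ = refl

  opaque
    count : (Fin n → Bool) → ℕ
    count f = sum (λ i → bit (f i))

    count-cong : {f g : Fin n → Bool} → (∀ i → f i ≡ g i) → count f ≡ count g
    count-cong eq = sum-cong-≗ (λ i → cong bit (eq i))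

    count-mono : {f g : Fin n → Bool} → (∀ i → T (f i) → T (g i)) → count f ≤ count g
    count-mono le = sum-mono (λ i → bit-mono (le i))

    count-squeeze : {f g : Fin n → Bool} → (∀ i → T (f i) → T (g i)) → count f ≡ count g → ∀ i → f i ≡ g i
    count-squeeze le eq i = bit-injective (sum-squeeze (λ i → bit-mono (le i)) eq i)

    count≤n : (f : Fin n → Bool) → count f ≤ n
    count≤n {n} f = ≤-trans (sum≤ {k = 1} {f = λ i → bit (f i)} (λ i → bit-mono {f i} {true} _)) (≤-reflexive (*-identityʳ n))

    count-true : ∀ n → count {n} (λ _ → true) ≡ n
    count-true zero = refl
    count-true (suc n) = cong suc (count-true n)

    count≡n⇒full : (f : Fin n → Bool) → count f ≡ n → ∀ i → T (f i)
    count≡n⇒full {n} f eq i =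
      subst T (sym (count-squeeze {g = λ _ → true} _ (trans eq (sym (count-true n))) i)) tt

    count≥1 : (f : Fin n → Bool) → ∀ i → T (f i) → 1 ≤ count f
    count≥1 f i fi = ≤-trans (≤-reflexive (sym (bit-T fi))) (term≤sum (λ i → bit (f i)) i)

    enumerate : (f : Fin n → Bool) → k ≤ count f →
                Σ (Fin k → Fin n) λ h → Injective _≡_ _≡_ h × (∀ i → T (f (h i)))
    enumerate {n} {zero} f _ = (λ ()) , (λ { {()} }) , (λ ())
    enumerate {suc n} {suc k} f le with f zero in eq
    ... | false = let h , inj , fh = enumerate (f ∘ suc) le
                  in suc ∘ h , (λ e → inj (Fin.suc-injective e)) , fh
    ... | true  = let h , inj , fh = enumerate (f ∘ suc) (s≤s⁻¹ le)
                  in (λ { zero → zero ; (suc i) → suc (h i) })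
                   , (λ { {zero} {zero} _ → refl ; {suc i} {suc j} e → cong suc (inj (Fin.suc-injective e)) })
                   , (λ { zero → subst T (sym eq) tt ; (suc i) → fh i })

    count-swap : (f : Fin d → Fin n → Bool) → sum (λ b → count (f b)) ≡ sum (λ a → count (λ b → f b a))
    count-swap {d} {n} f = ∑-comm {d} {n} (λ b a → bit (f b a))

  enumerate-subset : (F : Subset n) → k ≤ ∣ F ∣ →
                     Σ (Fin k → Fin n) λ h → Injective _≡_ _≡_ h × (∀ i → h i ∈ F)
  enumerate-subset {k = zero} F _ = (λ ()) , (λ { {()} }) , (λ ())
  enumerate-subset {k = suc k} (outside ∷ F) le =
    let h , inj , fh = enumerate-subset F le
    in suc ∘ h , (λ e → inj (Fin.suc-injective e)) , there ∘ fh
  enumerate-subset {k = suc k} (inside ∷ F) le =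
    let h , inj , fh = enumerate-subset F (s≤s⁻¹ le)
    in (λ { zero → zero ; (suc i) → suc (h i) })
     , (λ { {zero} {zero} _ → refl ; {suc i} {suc j} e → cong suc (inj (Fin.suc-injective e)) })
     , (λ { zero → here ; (suc i) → there (fh i) })

  insert : Fin n → Subset n → Subset n
  insert x F = F Vec.[ x ]≔ inside

  ∣insert∣ : (x : Fin n) (F : Subset n) → ¬ x ∈ F → ∣ insert x F ∣ ≡ suc ∣ F ∣
  ∣insert∣ zero (inside ∷ F) x∉F = ⊥-elim (x∉F here)
  ∣insert∣ zero (outside ∷ F) x∉F = refl
  ∣insert∣ (suc x) (inside ∷ F) x∉F = cong suc (∣insert∣ x F (x∉F ∘ there))
  ∣insert∣ (suc x) (outside ∷ F) x∉F = ∣insert∣ x F (x∉F ∘ there)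

  ∈-insert⁻ : ∀ (x : Fin n) F {y} → y ∈ insert x F → ¬ x ≡ y → y ∈ F
  ∈-insert⁻ zero (_ ∷ F) here x≢y = ⊥-elim (x≢y refl)
  ∈-insert⁻ zero (_ ∷ F) (there y∈F) _ = there y∈F
  ∈-insert⁻ (suc x) (_ ∷ F) here _ = here
  ∈-insert⁻ (suc x) (_ ∷ F) (there y∈F) x≢y = there (∈-insert⁻ x F y∈F (x≢y ∘ cong suc))

  image : (g : Fin k → Fin n) → Subset n
  image {zero} g = ⊥
  image {suc k} g = insert (g zero) (image (g ∘ suc))

  ∈-image⁻ : (g : Fin k → Fin n) → ∀ {x} → x ∈ image g → ∃ λ i → g i ≡ x
  ∈-image⁻ {zero} g x∈ = ⊥-elim (∉⊥ x∈)
  ∈-image⁻ {suc k} g {x} x∈ with g zero Fin.≟ x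
  ... | yes eq = zero , eq
  ... | no ne = let i , eq = ∈-image⁻ (g ∘ suc) (∈-insert⁻ (g zero) _ x∈ ne) in suc i , eq

  ∣image∣ : (g : Fin k → Fin n) → Injective _≡_ _≡_ g → ∣ image g ∣ ≡ k
  ∣image∣ {zero} {n} g inj = ∣⊥∣≡0 n
  ∣image∣ {suc k} g inj = trans (∣insert∣ (g zero) _ fresh) (cong suc (∣image∣ (g ∘ suc) (Fin.suc-injective ∘ inj)))
    where
    fresh : ¬ g zero ∈ image (g ∘ suc)
    fresh x∈ with ∈-image⁻ (g ∘ suc) x∈
    ... | i , eq with inj {suc i} {zero} eq
    ...   | ()

  firstJust : {A : Set} → A → (Fin d → Maybe A) → A
  firstJust {zero} a g = a
  firstJust {suc d} a g with g zero
  ... | just x = x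
  ... | nothing = firstJust a (g ∘ suc)

  firstJust-cong : {A : Set} (a : A) {g g′ : Fin d → Maybe A} → (∀ i → g i ≡ g′ i) → firstJust a g ≡ firstJust a g′
  firstJust-cong {zero} a eq = refl
  firstJust-cong {suc d} a {g} {g′} eq with g zero | g′ zero | eq zero
  ... | just x  | just .x | refl = refl
  ... | nothing | nothing | refl = firstJust-cong a (eq ∘ suc)

  -- The search is known to succeed, so the defaults `a` and `b` may be unrelated. A fixed default
  -- could not be equivariant.
  firstJust-map : {A B : Set} (f : A → B) (a : A) (b : B) (g : Fin d → Maybe A) {g′ : Fin d → Maybe B} →
    (∀ i → g′ i ≡ Maybe.map f (g i)) → (∃ λ i → ∃ λ x → g i ≡ just x) → firstJust b g′ ≡ f (firstJust a g)
  firstJust-map {suc d} f a b g {g′} eq (i , x , gi) with g zero in gz | g′ zero | eq zero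
  ... | just y  | .(just (f y)) | refl = refl
  ... | nothing | .nothing      | refl = firstJust-map f a b (g ∘ suc) (eq ∘ suc) (later i gi)
    where
    later : ∀ i → g i ≡ just x → ∃ λ i → ∃ λ x → g (suc i) ≡ just x
    later zero gi with trans (sym gz) gi
    ... | ()
    later (suc i) gi = i , x , gi

  mod-inverse : ∀ {p} .{{_ : NonZero p}} → Prime p → ∀ j → 0 < j → j < p → ∃ λ v → (v * j) % p ≡ 1 % p
  mod-inverse {p@(suc p′)} pr j 0<j j<p with coprime-Bézout (prime⇒coprime pr {{>-nonZero 0<j}} j<p)
  ... | Bézout.-+ x y eq = y , (begin
        (y * j) % p      ≡⟨ cong (_% p) (sym eq) ⟩
        (1 + x * p) % p  ≡⟨ [m+kn]%n≡m%n 1 x p ⟩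
        1 % p            ∎)
  -- In this case y j is -1 modulo p, and the factor `p′`, also -1, corrects the sign.
  ... | Bézout.+- x y eq = p′ * y , (begin
        (p′ * y * j) % p                 ≡⟨ [m+kn]%n≡m%n (p′ * y * j) 1 p ⟨
        (p′ * y * j + 1 * p) % p         ≡⟨ cong (_% p) (ring p′ y j) ⟩
        (1 + p′ * (1 + y * j)) % p       ≡⟨ cong (λ z → (1 + p′ * z) % p) eq ⟩
        (1 + p′ * (x * p)) % p           ≡⟨ cong (λ z → (1 + z) % p) (sym (*-assoc p′ x p)) ⟩
        (1 + (p′ * x) * p) % p           ≡⟨ [m+kn]%n≡m%n 1 (p′ * x) p ⟩
        1 % p                            ∎)
        where ring : ∀ a y j → a * y * j + 1 * (1 + a) ≡ 1 + a * (1 + y * j)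
              ring = solve-∀

  module Rows (p′ : ℕ) (pr : Prime (suc p′)) where
    open Signs p′ public renaming (r to p)

    opaque
      inv : ℕ → ℕ
      inv j with 0 <? j | j <? p
      ... | yes l | yes u = proj₁ (mod-inverse pr j l u)
      ... | _     | _     = 0

      inv-spec : ∀ j → 0 < j → j < p → (inv j * j) % p ≡ 1 % p
      inv-spec j l u with 0 <? j | j <? p
      ... | yes l′ | yes u′ = proj₂ (mod-inverse pr j l′ u′)
      ... | no ¬l  | _      = ⊥-elim (¬l l)
      ... | yes _  | no ¬u  = ⊥-elim (¬u u)

    iter-comm : ∀ {A : Set} k (f : A → A) x → iter k f (f x) ≡ f (iter k f x)
    iter-comm zero f x = refl
    iter-comm (suc k) f x = iter-comm k f (f x)

    sum-rot : (f : Fin p → ℕ) → sum f ≡ sum (f ∘ rot)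
    sum-rot f = sum-permute f (mk↔ₛ′ rot (iter p′ rot)
      (λ i → trans (sym (iter-comm p′ rot i)) (iter-rot i)) iter-rot)

    Row : Set
    Row = Fin p → Bool

    Rotated : Row → Row → Set
    Rotated f g = ∀ ε → g (rot ε) ≡ f ε

    opaque
      unfolding count

      count-rot : ∀ {f g} → Rotated f g → count g ≡ count f
      count-rot {f} {g} rel = trans (sum-rot (λ ε → bit (g ε))) (count-cong {f = g ∘ rot} {g = f} rel)

      weight : Row → ℕ
      weight f = sum (λ ε → toℕ ε * bit (f ε))

      -- Each sign of the row moves up by 1, except that the last one returns to 0 and loses an
      -- extra p; z counts these losses.
      weight-rot : ∀ {f g} → Rotated f g → ∃ λ z → weight g + z * p ≡ count f + weight f
      weight-rot {f} {g} rel = z , (begin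
        weight g + z * p
          ≡⟨ cong₂ _+_ (trans (sum-rot (λ ε → toℕ ε * bit (g ε))) (sum-cong-≗ (λ ε → cong₂ (λ x b → x * bit b) (toℕ-rot ε) (rel ε))))
               (trans (*-comm z p) (*-distribˡ-sum p wraps)) ⟩
        sum (λ ε → (suc (toℕ ε) % p) * bit (f ε)) + sum (λ ε → p * wraps ε)
          ≡⟨ ∑-distrib-+ (λ ε → (suc (toℕ ε) % p) * bit (f ε)) (λ ε → p * wraps ε) ⟨
        sum (λ ε → (suc (toℕ ε) % p) * bit (f ε) + p * wraps ε)
          ≡⟨ sum-cong-≗ (λ ε → trans (ring (suc (toℕ ε) % p) (suc (toℕ ε) / p) p (bit (f ε)))
               (cong (_* bit (f ε)) (sym (m≡m%n+[m/n]*n (suc (toℕ ε)) p)))) ⟩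
        sum (λ ε → bit (f ε) + toℕ ε * bit (f ε))
          ≡⟨ ∑-distrib-+ (λ ε → bit (f ε)) (λ ε → toℕ ε * bit (f ε)) ⟩
        count f + weight f ∎)
        where
        wraps : Fin p → ℕ
        wraps ε = (suc (toℕ ε) / p) * bit (f ε)
        z : ℕ
        z = sum wraps
        ring : ∀ m q p b → m * b + p * (q * b) ≡ (m + q * p) * b
        ring = solve-∀

      weight-cong : ∀ {f g} → (∀ ε → f ε ≡ g ε) → weight f ≡ weight g
      weight-cong eq = sum-cong-≗ (λ ε → cong (λ b → toℕ ε * bit b) (eq ε))

    opaque
      -- Rotating a row by one raises its weight by its count modulo p, so dividing the
      -- weight by the count turns this into a rotation of the sign by one.
      σ : Row → Sign
      σ f = fromℕ< (m%n<n (inv (count f) * weight f) p)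

      σ-cong : ∀ {f g} → (∀ ε → f ε ≡ g ε) → σ f ≡ σ g
      σ-cong {f} {g} eq = toℕ-injective (trans (toℕ-fromℕ< _) (trans
        (cong₂ (λ x y → (inv x * y) % p) (count-cong {f = f} {g = g} eq) (weight-cong {f} {g} eq))
        (sym (toℕ-fromℕ< _))))

      -- Primality enters here: a count strictly between 0 and p is invertible modulo p. The full
      -- row is excluded, being fixed by rotation.
      σ-rot : ∀ {f g} → Rotated f g → 0 < count f → count f < p → σ g ≡ rot (σ f)
      σ-rot {f} {g} rel l u = toℕ-injective (begin
        toℕ (σ g)                                    ≡⟨ toℕ-fromℕ< _ ⟩
        (inv (count g) * weight g) % p               ≡⟨ cong (λ j → (inv j * weight g) % p) (count-rot {f} {g} rel) ⟩
        (v * weight g) % p                           ≡⟨ [m+kn]%n≡m%n (v * weight g) (v * z) p ⟨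
        (v * weight g + v * z * p) % p               ≡⟨ cong (_% p) (ring₁ v (weight g) z p) ⟩
        (v * (weight g + z * p)) % p                 ≡⟨ cong (λ x → (v * x) % p) zeq ⟩
        (v * (count f + weight f)) % p               ≡⟨ cong (_% p) (*-distribˡ-+ v (count f) (weight f)) ⟩
        (v * count f + v * weight f) % p             ≡⟨ %-distribˡ-+ (v * count f) _ p ⟩
        ((v * count f) % p + (v * weight f) % p) % p ≡⟨ cong₂ (λ x y → (x + y) % p) (inv-spec (count f) l u) (sym (m%n%n≡m%n (v * weight f) p)) ⟩
        (1 % p + (v * weight f) % p % p) % p         ≡⟨ %-distribˡ-+ 1 ((v * weight f) % p) p ⟨
        suc ((v * weight f) % p) % p                 ≡⟨ cong (λ x → suc x % p) (sym (toℕ-fromℕ< _)) ⟩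
        suc (toℕ (σ f)) % p                          ≡⟨ toℕ-rot (σ f) ⟨
        toℕ (rot (σ f))                              ∎)
        where
        v z : ℕ
        v = inv (count f)
        z = proj₁ (weight-rot {f} {g} rel)
        zeq : weight g + z * p ≡ count f + weight f
        zeq = proj₂ (weight-rot {f} {g} rel)
        ring₁ : ∀ v w z p → v * w + v * z * p ≡ v * (w + z * p)
        ring₁ = solve-∀

    lookup : E n → Fin n → Maybe Sign
    lookup (pt a) zero = just a
    lookup (pt a) (suc i) = nothing
    lookup (ι X) zero = nothing
    lookup (ι X) (suc i) = lookup X i
    lookup (κ a X) zero = just a
    lookup (κ a X) (suc i) = lookup X i

    lookup-act : (X : E n) → ∀ i → lookup (act X) i ≡ Maybe.map rot (lookup X i)
    lookup-act (pt a) zero = refl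
    lookup-act (pt a) (suc i) = refl
    lookup-act (ι X) zero = refl
    lookup-act (ι X) (suc i) = lookup-act X i
    lookup-act (κ a X) zero = refl
    lookup-act (κ a X) (suc i) = lookup-act X i

    lookup-⊑ : {X Y : E n} → X ⊑ Y → ∀ i {a} → lookup X i ≡ just a → lookup Y i ≡ just a
    lookup-⊑ pt⊑pt i eq = eq
    lookup-⊑ pt⊑κ zero eq = eq
    lookup-⊑ (ι⊑ι p) (suc i) eq = lookup-⊑ p i eq
    lookup-⊑ (ι⊑κ p) (suc i) eq = lookup-⊑ p i eq
    lookup-⊑ (κ⊑κ p) zero eq = eq
    lookup-⊑ (κ⊑κ p) (suc i) eq = lookup-⊑ p i eq

    nonzero : (X : E n) → ∃ λ i → ∃ λ a → lookup X i ≡ just a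
    nonzero (pt a) = zero , a , refl
    nonzero (ι X) = let i , eq = nonzero X in suc i , eq
    nonzero (κ a X) = zero , a , refl

    anyE? : {P : E n → Set} → (∀ X → Dec (P X)) → Dec (∃ P)
    anyE? {zero} P? = no λ { (() , _) }
    anyE? {suc n} P? with Fin.any? (λ a → P? (pt a)) | anyE? (λ X → P? (ι X)) | Fin.any? (λ a → anyE? (λ X → P? (κ a X)))
    ... | yes (a , p) | _ | _ = yes (pt a , p)
    ... | no _ | yes (X , p) | _ = yes (ι X , p)
    ... | no _ | no _ | yes (a , X , p) = yes (κ a X , p)
    ... | no ¬a | no ¬b | no ¬c = no λ { (pt a , p) → ¬a (a , p) ; (ι X , p) → ¬b (X , p) ; (κ a X , p) → ¬c (a , X , p) }

-- Monochromatic families of transversal sets for prime r.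

module PrimeCase where
  open ZrTucker
  open Counting
  open import Data.Nat
  open import Data.Nat.Properties
  open import Data.Nat.Primality using (Prime; prime⇒nonTrivial)
  open import Algebra.Properties.Semiring.Sum +-*-semiring using (sum; sum-cong-≗)
  open import Data.Fin as Fin using (Fin; zero; suc; toℕ; fromℕ<)
  open import Data.Fin.Properties as Fin using (toℕ-fromℕ<)
  open import Data.Fin.Subset using (Subset; _∈_; ∣_∣; _∩_; Empty)
  open import Data.Fin.Subset.Properties using (_∈?_; anySubset?; x∈p∩q⁻)
  open import Data.Bool using (T; T?)
  open import Data.Maybe as Maybe using (Maybe; just; nothing)
  open import Data.Maybe.Properties using (just-injective; map-id) renaming (≡-dec to ≡-dec-Maybe)
  open import Data.Empty using (⊥-elim)
  open import Data.Product
  open import Data.Sum using ([_,_]′)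
  open import Function
  open import Function.Definitions using (Injective)
  open import Relation.Nullary
  open import Relation.Nullary.Decidable as Dec using (toSum; ⌊_⌋; _×-dec_; _→-dec_)
  open import Relation.Binary.PropositionalEquality

  private variable
    n m q : ℕ

  -- The ground set is the image of emb, and the blocks are the fibres of blk.
  record Good (emb : Fin m → Fin n) (blk : Fin m → Fin q) (k : ℕ) (F : Subset n) : Set where
    constructor good
    field
      size        : ∣ F ∣ ≡ k
      support     : ∀ x → x ∈ F → ∃ λ i → emb i ≡ x
      transversal : ∀ i j → emb i ∈ F → emb j ∈ F → blk i ≡ blk j → i ≡ j

  open Good public

  Good? : ∀ (emb : Fin m → Fin n) (blk : Fin m → Fin q) k F → Dec (Good emb blk k F)
  Good? emb blk k F = Dec.map′ (λ (a , b , c) → good a b c) (λ g → g .size , g .support , g .transversal)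
    (∣ F ∣ ≟ k
     ×-dec Fin.all? (λ x → x ∈? F →-dec Fin.any? (λ i → emb i Fin.≟ x))
     ×-dec Fin.all? (λ i → Fin.all? λ j → emb i ∈? F →-dec (emb j ∈? F →-dec (blk i Fin.≟ blk j →-dec i Fin.≟ j))))

  record Monochromatic (r : ℕ) (emb : Fin m → Fin n) (blk : Fin m → Fin q) (k : ℕ) {c : ℕ}
                       (col : ∀ F → Good emb blk k F → Fin c) : Set where
    field
      colour   : Fin c
      member   : Fin r → Subset n
      isGood   : ∀ a → Good emb blk k (member a)
      coloured : ∀ a → col (member a) (isGood a) ≡ colour
      disjoint : ∀ a b → ¬ a ≡ b → Empty (member a ∩ member b)

  open Monochromatic public

  Separates : ∀ {r} → (Fin m → Fin q) → (Fin m → Fin r) → Set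
  Separates blk pos = ∀ {i j} → blk i ≡ blk j → pos i ≡ pos j → i ≡ j

  -- The Alon–Frankl–Lovász theorem for k-sets transversal to a partition into blocks of
  -- size at most r; block sizes are bounded by positions pos inside the blocks.
  AFL : ℕ → Set
  AFL r = ∀ {n m q} k′ c (emb : Fin m → Fin n) → Injective _≡_ _≡_ emb →
    (blk : Fin m → Fin q) (pos : Fin m → Fin r) → Separates blk pos →
    (col : ∀ F → Good emb blk (suc k′) F → Fin c) →
    r * k′ + c * (r ∸ 1) < m → Monochromatic r emb blk (suc k′) col

  module _ (p′ : ℕ) (pr : Prime (suc p′)) where
    open Rows p′ pr

    module _ {n m′ q} (k′ c : ℕ) (emb : Fin (suc m′) → Fin n) (emb-inj : Injective _≡_ _≡_ emb)
             (blk : Fin (suc m′) → Fin q) (pos : Fin (suc m′) → Fin p) (sep : Separates blk pos)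
             (col : ∀ F → Good emb blk (suc k′) F → Fin c) where
      private
        width = suc m′
        k = suc k′

      p≥2 : 2 ≤ p
      p≥2 = nonTrivial⇒n>1 p {{prime⇒nonTrivial pr}}

      In : Fin q → E width → Fin p → Fin width → Set
      In b X ε i = blk i ≡ b × lookup X i ≡ just ε

      _≟M_ : {d : ℕ} (x y : Maybe (Fin d)) → Dec (x ≡ y)
      _≟M_ = ≡-dec-Maybe Fin._≟_

      Row? : ∀ b X ε → Dec (∃ (In b X ε))
      Row? b X ε = Fin.any? λ i → (blk i Fin.≟ b) ×-dec (lookup X i ≟M just ε)

      opaque
        row : Fin q → E width → Row
        row b X ε = ⌊ Row? b X ε ⌋

        row⁻ : ∀ b X ε → T (row b X ε) → ∃ (In b X ε)
        row⁻ b X ε = witness (Row? b X ε)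

        row⁺ : ∀ b X ε → ∃ (In b X ε) → T (row b X ε)
        row⁺ b X ε = holds (Row? b X ε)

      -- Position zero of a block holds at most one element, so this row has at most one sign. It
      -- stands in for the row of a block in which all p signs occur.
      Row₀? : ∀ b X ε → Dec (∃ λ i → In b X ε i × pos i ≡ zero)
      Row₀? b X ε = Fin.any? λ i → ((blk i Fin.≟ b) ×-dec (lookup X i ≟M just ε)) ×-dec (pos i Fin.≟ zero)

      opaque
        row₀ : Fin q → E width → Row
        row₀ b X ε = ⌊ Row₀? b X ε ⌋

        row₀⁻ : ∀ b X ε → T (row₀ b X ε) → ∃ λ i → In b X ε i × pos i ≡ zero
        row₀⁻ b X ε = witness (Row₀? b X ε)

        row₀⁺ : ∀ b X ε → (∃ λ i → In b X ε i × pos i ≡ zero) → T (row₀ b X ε)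
        row₀⁺ b X ε = holds (Row₀? b X ε)

      InClass : E width → Fin p → Subset n → Set
      InClass X ε F = ∀ i → emb i ∈ F → lookup X i ≡ just ε

      -- `col` may depend on the proof of goodness. Reading the colour off the decision `Good?`
      -- gives every good set a single colour.
      paint : ∀ F → Dec (Good emb blk k F) → Maybe (Fin c)
      paint F (yes g) = just (col F g)
      paint F (no _)  = nothing

      Hit : Fin c → E width → Fin p → Subset n → Set
      Hit j X ε F = paint F (Good? emb blk k F) ≡ just j × InClass X ε F

      Hit? : ∀ j X ε → Dec (∃ (Hit j X ε))
      Hit? j X ε = anySubset? λ F → (paint F (Good? emb blk k F) ≟M just j)
        ×-dec Fin.all? (λ i → emb i ∈? F →-dec lookup X i ≟M just ε)

      opaque
        hit : Fin c → E width → Row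
        hit j X ε = ⌊ Hit? j X ε ⌋

        hit⁻ : ∀ j X ε → T (hit j X ε) → ∃ (Hit j X ε)
        hit⁻ j X ε = witness (Hit? j X ε)

        hit⁺ : ∀ j X ε → ∃ (Hit j X ε) → T (hit j X ε)
        hit⁺ j X ε = holds (Hit? j X ε)

      lookup-act-just : ∀ (X : E width) i ε → lookup X i ≡ just ε → lookup (act X) i ≡ just (rot ε)
      lookup-act-just X i ε eq = trans (lookup-act X i) (cong (Maybe.map rot) eq)

      lookup-act-just⁻ : ∀ (X : E width) i ε → lookup (act X) i ≡ just (rot ε) → lookup X i ≡ just ε
      lookup-act-just⁻ X i ε eq with lookup X i | trans (sym (lookup-act X i)) eq
      ... | just δ | eq′ = cong just (rot-injective (just-injective eq′))

      row-act : ∀ b X → Rotated (row b X) (row b (act X))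
      row-act b X ε = T-ext
        (λ t → let i , bi , e = row⁻ b (act X) (rot ε) t in row⁺ b X ε (i , bi , lookup-act-just⁻ X i ε e))
        (λ t → let i , bi , e = row⁻ b X ε t in row⁺ b (act X) (rot ε) (i , bi , lookup-act-just X i ε e))

      row₀-act : ∀ b X → Rotated (row₀ b X) (row₀ b (act X))
      row₀-act b X ε = T-ext
        (λ t → let i , (bi , e) , z = row₀⁻ b (act X) (rot ε) t in row₀⁺ b X ε (i , (bi , lookup-act-just⁻ X i ε e) , z))
        (λ t → let i , (bi , e) , z = row₀⁻ b X ε t in row₀⁺ b (act X) (rot ε) (i , (bi , lookup-act-just X i ε e) , z))

      hit-act : ∀ j X → Rotated (hit j X) (hit j (act X))
      hit-act j X ε = T-ext
        (λ t → let F , painted , cl = hit⁻ j (act X) (rot ε) t in hit⁺ j X ε (F , painted , λ i i∈F → lookup-act-just⁻ X i ε (cl i i∈F)))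
        (λ t → let F , painted , cl = hit⁻ j X ε t in hit⁺ j (act X) (rot ε) (F , painted , λ i i∈F → lookup-act-just X i ε (cl i i∈F)))

      row-mono : ∀ {X Y} → X ⊑ Y → ∀ b ε → T (row b X ε) → T (row b Y ε)
      row-mono {X} {Y} X⊑Y b ε t =
        let i , bi , e = row⁻ b X ε t in row⁺ b Y ε (i , bi , lookup-⊑ X⊑Y i e)

      hit-mono : ∀ {X Y} → X ⊑ Y → ∀ j ε → T (hit j X ε) → T (hit j Y ε)
      hit-mono {X} {Y} X⊑Y j ε t =
        let F , painted , cl = hit⁻ j X ε t in hit⁺ j Y ε (F , painted , λ i i∈F → lookup-⊑ X⊑Y i (cl i i∈F))

      -- A block of size p whose p signs all occur carries a permutation of the signs.
      module _ (b : Fin q) (X : E width) (full : ∀ ε → T (row b X ε)) where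
        at : Fin p → Fin width
        at ε = proj₁ (row⁻ b X ε (full ε))

        at-In : ∀ ε → In b X ε (at ε)
        at-In ε = proj₂ (row⁻ b X ε (full ε))

        pos-at-injective : ∀ {ε δ} → pos (at ε) ≡ pos (at δ) → ε ≡ δ
        pos-at-injective {ε} {δ} eq = just-injective (trans (sym (proj₂ (at-In ε)))
          (trans (cong (lookup X) (sep (trans (proj₁ (at-In ε)) (sym (proj₁ (at-In δ)))) eq)) (proj₂ (at-In δ))))

        -- The p signs occupy distinct positions among p. If they avoided position zero, `punchOut`
        -- would squeeze them into `p′` places.
        origin : ∃ λ ε → pos (at ε) ≡ zero
        origin with Fin.any? (λ ε → pos (at ε) Fin.≟ zero)
        ... | yes found = found
        ... | no none = ⊥-elim (n≮n p′ (Fin.injective⇒≤ {f = λ ε → Fin.punchOut (avoid ε)}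
                (λ {ε} {δ} eq → pos-at-injective (Fin.punchOut-injective (avoid ε) (avoid δ) eq))))
          where avoid : ∀ ε → ¬ zero ≡ pos (at ε)
                avoid ε eq = none (ε , sym eq)

        origin-row₀ : T (row₀ b X (proj₁ origin))
        origin-row₀ = row₀⁺ b X _ (_ , at-In _ , proj₂ origin)

        -- Since the block is full in X, its position zero already has a sign there, and larger
        -- vectors keep it.
        row₀-above : ∀ {Y} → X ⊑ Y → ∀ ε → row₀ b X ε ≡ row₀ b Y ε
        row₀-above {Y} X⊑Y ε = T-ext
          (λ t → let i , (bi , e) , z = row₀⁻ b X ε t in row₀⁺ b Y ε (i , (bi , lookup-⊑ X⊑Y i e) , z))
          (λ t → let i , (bi , e) , z = row₀⁻ b Y ε t
                     o , zo = origin
                     ao = at-In o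
                     i≡at = sep {i} {at o} (trans bi (sym (proj₁ ao))) (trans z (sym zo))
                     o≡ε = just-injective (trans (sym (lookup-⊑ X⊑Y (at o) (proj₂ ao))) (trans (cong (lookup Y) (sym i≡at)) e))
                 in subst (λ δ → T (row₀ b X δ)) o≡ε origin-row₀)

      row₀-proper : ∀ b X → count (row₀ b X) < p
      row₀-proper b X = ≤∧≢⇒< (count≤n (row₀ b X)) λ eq →
        let zero′ = fromℕ< {0} (≤-trans (s≤s z≤n) p≥2)
            one′ = fromℕ< {1} p≥2
            full = count≡n⇒full (row₀ b X) eq
            i , (bi , e) , z = row₀⁻ b X zero′ (full zero′)
            j , (bj , e′) , z′ = row₀⁻ b X one′ (full one′)
            same = just-injective (trans (sym e) (trans (cong (lookup X) (sep {i} {j} (trans bi (sym bj)) (trans z (sym z′)))) e′))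
        in 0≢1+n (trans (sym (toℕ-fromℕ< (≤-trans (s≤s z≤n) p≥2))) (trans (cong toℕ same) (toℕ-fromℕ< p≥2)))

      ρ η : E width → ℕ
      ρ X = sum (λ b → count (row b X))
      η X = sum (λ j → count (hit j X))

      ρ-mono : ∀ {X Y} → X ⊑ Y → ρ X ≤ ρ Y
      ρ-mono {X} {Y} X⊑Y = sum-mono (λ b → count-mono {f = row b X} {row b Y} (row-mono X⊑Y b))

      η-mono : ∀ {X Y} → X ⊑ Y → η X ≤ η Y
      η-mono {X} {Y} X⊑Y = sum-mono (λ j → count-mono {f = hit j X} {hit j Y} (hit-mono X⊑Y j))

      ρ-act : ∀ X → ρ (act X) ≡ ρ X
      ρ-act X = sum-cong-≗ (λ b → count-rot {row b X} {row b (act X)} (row-act b X))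

      ρ≥1 : ∀ X → 1 ≤ ρ X
      ρ≥1 X = let i , a , e = nonzero X in
        ≤-trans (count≥1 (row (blk i) X) a (row⁺ (blk i) X a (i , refl , e))) (term≤sum (λ b → count (row b X)) (blk i))

      row-jump : ∀ X → ∃ λ b → 0 < count (row b X)
      row-jump X = let i , a , e = nonzero X in
        blk i , count≥1 (row (blk i) X) a (row⁺ (blk i) X a (i , refl , e))

      -- More than p k′ (block, sign) incidences give k blocks seen by a single sign.
      hit-exists : ∀ X → p * k′ < ρ X → ∃ λ j → ∃ λ ε → T (hit j X ε)
      hit-exists X lt = found (Good? emb blk k F) refl
        where
        swapped : p * k′ < sum (λ ε → count (λ b → row b X ε))
        swapped = ≤-trans lt (≤-reflexive (count-swap (λ b ε → row b X ε)))
        ε = proj₁ (sum-pigeonhole {g = λ ε → count (λ b → row b X ε)} swapped)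
        enum = enumerate (λ b → row b X ε) (proj₂ (sum-pigeonhole {g = λ ε → count (λ b → row b X ε)} swapped))
        h = proj₁ enum
        h-inj = proj₁ (proj₂ enum)
        pick : ∀ a → ∃ (In (h a) X ε)
        pick a = row⁻ (h a) X ε (proj₂ (proj₂ enum) a)
        g : Fin k → Fin n
        g a = emb (proj₁ (pick a))
        g-blk : ∀ a i → g a ≡ emb i → blk i ≡ h a
        g-blk a i eq = trans (cong blk (sym (emb-inj eq))) (proj₁ (proj₂ (pick a)))
        F = image g
        F-good : Good emb blk k F
        F-good .size = ∣image∣ g (λ {a} {b} eq → h-inj (trans (sym (proj₁ (proj₂ (pick a)))) (g-blk b _ (sym eq))))
        F-good .support x x∈F = let a , eq = ∈-image⁻ g x∈F in _ , eq
        F-good .transversal i j i∈F j∈F eq =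
          let a , ea = ∈-image⁻ g i∈F
              b , eb = ∈-image⁻ g j∈F
              a≡b = h-inj (trans (sym (g-blk a i ea)) (trans eq (g-blk b j eb)))
          in emb-inj (trans (sym ea) (trans (cong g a≡b) eb))
        F-class : InClass X ε F
        F-class i i∈F = let a , ea = ∈-image⁻ g i∈F in
          trans (cong (lookup X) (sym (emb-inj ea))) (proj₂ (proj₂ (pick a)))
        found : (d : Dec (Good emb blk k F)) → d ≡ Good? emb blk k F → ∃ λ j → ∃ λ ε → T (hit j X ε)
        found (no ¬g) _ = ⊥-elim (¬g F-good)
        found (yes g) eq = col F g , ε , hit⁺ (col F g) X ε (F , cong (paint F) (sym eq) , F-class)

      paint-just : ∀ F j (d : Dec (Good emb blk k F)) → paint F d ≡ just j → ∃ λ g → col F g ≡ j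
      paint-just F j (yes g) eq = g , just-injective eq

      assemble : ∀ X j → (∀ ε → T (hit j X ε)) → Monochromatic p emb blk k col
      assemble X j full = record
        { colour = j
        ; member = F
        ; isGood = λ ε → proj₁ (F-good ε)
        ; coloured = λ ε → proj₂ (F-good ε)
        ; disjoint = λ { a b a≢b (x , x∈) →
            let x∈a , x∈b = x∈p∩q⁻ (F a) (F b) x∈
                i , eq = proj₁ (F-good a) .support x x∈a
                in-a = proj₂ (proj₂ (F-hit a)) i (subst (_∈ F a) (sym eq) x∈a)
                in-b = proj₂ (proj₂ (F-hit b)) i (subst (_∈ F b) (sym eq) x∈b)
            in a≢b (just-injective (trans (sym in-a) in-b)) } }
        where
        F-hit : ∀ ε → ∃ (Hit j X ε)
        F-hit ε = hit⁻ j X ε (full ε)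
        F = λ ε → proj₁ (F-hit ε)
        F-good = λ ε → paint-just (F ε) j _ (proj₁ (proj₂ (F-hit ε)))

      properSign : Row → Maybe Sign
      properSign f with 0 <? count f
      ... | yes _ = just (σ f)
      ... | no _ = nothing

      -- A full row has no equivariant sign of its own, so the second row, the one of position zero,
      -- decides.
      blockSign : Row → Row → Maybe Sign
      blockSign f f₀ with 0 <? count f | count f <? p
      ... | yes _ | yes _ = just (σ f)
      ... | yes _ | no _  = just (σ f₀)
      ... | no _  | _     = nothing

      lowSign highSign : E width → Sign
      lowSign X = firstJust zero (λ b → blockSign (row b X) (row₀ b X))
      highSign X = firstJust zero (λ j → properSign (hit j X))

      properSign-nonempty : ∀ {f} → 0 < count f → properSign f ≡ just (σ f)
      properSign-nonempty {f} l with 0 <? count f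
      ... | yes _ = refl
      ... | no ¬l = ⊥-elim (¬l l)

      properSign-empty : ∀ {f} → ¬ 0 < count f → properSign f ≡ nothing
      properSign-empty {f} ¬l with 0 <? count f
      ... | yes l = ⊥-elim (¬l l)
      ... | no _ = refl

      blockSign-proper : ∀ {f f₀} → 0 < count f → count f < p → blockSign f f₀ ≡ just (σ f)
      blockSign-proper {f} l u with 0 <? count f | count f <? p
      ... | yes _ | yes _ = refl
      ... | yes _ | no ¬u = ⊥-elim (¬u u)
      ... | no ¬l | _     = ⊥-elim (¬l l)

      blockSign-full : ∀ {f f₀} → 0 < count f → ¬ count f < p → blockSign f f₀ ≡ just (σ f₀)
      blockSign-full {f} l ¬u with 0 <? count f | count f <? p
      ... | yes _ | yes u = ⊥-elim (¬u u)
      ... | yes _ | no _  = refl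
      ... | no ¬l | _     = ⊥-elim (¬l l)

      blockSign-empty : ∀ {f f₀} → ¬ 0 < count f → blockSign f f₀ ≡ nothing
      blockSign-empty {f} ¬l with 0 <? count f | count f <? p
      ... | yes l | _ = ⊥-elim (¬l l)
      ... | no _  | _ = refl

      blockSign-map : ∀ (ψ : Sign → Sign) {f f₀ g g₀} → count g ≡ count f →
        (0 < count f → count f < p → σ g ≡ ψ (σ f)) → (0 < count f → ¬ count f < p → σ g₀ ≡ ψ (σ f₀)) →
        blockSign g g₀ ≡ Maybe.map ψ (blockSign f f₀)
      blockSign-map ψ {f} {f₀} {g} {g₀} eq proper full with 0 <? count f | count f <? p
      ... | yes l | yes u = trans (blockSign-proper (subst (0 <_) (sym eq) l) (subst (_< p) (sym eq) u)) (cong just (proper l u))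
      ... | yes l | no ¬u = trans (blockSign-full (subst (0 <_) (sym eq) l) (¬u ∘ subst (_< p) eq)) (cong just (full l ¬u))
      ... | no ¬l | _     = blockSign-empty (¬l ∘ subst (0 <_) eq)

      properSign-map : ∀ (ψ : Sign → Sign) {f g} → count g ≡ count f →
        (0 < count f → σ g ≡ ψ (σ f)) → properSign g ≡ Maybe.map ψ (properSign f)
      properSign-map ψ {f} eq nonempty with 0 <? count f
      ... | yes l = trans (properSign-nonempty (subst (0 <_) (sym eq) l)) (cong just (nonempty l))
      ... | no ¬l = properSign-empty (¬l ∘ subst (0 <_) eq)

      row-full : ∀ b X → ¬ count (row b X) < p → ∀ ε → T (row b X ε)
      row-full b X ¬u = count≡n⇒full (row b X) (≤-antisym (count≤n (row b X)) (≮⇒≥ ¬u))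

      blockSign-act : ∀ b X → blockSign (row b (act X)) (row₀ b (act X)) ≡ Maybe.map rot (blockSign (row b X) (row₀ b X))
      blockSign-act b X = blockSign-map rot (count-rot {row b X} {row b (act X)} (row-act b X))
        (σ-rot {row b X} {row b (act X)} (row-act b X))
        (λ _ ¬u → σ-rot {row₀ b X} {row₀ b (act X)} (row₀-act b X)
          (count≥1 (row₀ b X) _ (origin-row₀ b X (row-full b X ¬u))) (row₀-proper b X))

      blockSign-just : ∀ f f₀ → 0 < count f → ∃ λ a → blockSign f f₀ ≡ just a
      blockSign-just f f₀ l = [ (λ u → _ , blockSign-proper l u) , (λ ¬u → _ , blockSign-full l ¬u) ]′ (toSum (count f <? p))

      lowSign-act : ∀ X → lowSign (act X) ≡ rot (lowSign X)
      lowSign-act X = firstJust-map rot zero zero _ (λ b → blockSign-act b X)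
        (let b , l = row-jump X in b , blockSign-just (row b X) (row₀ b X) l)

      blockSign-cong : ∀ b {X Y} → X ⊑ Y → (∀ ε → row b X ε ≡ row b Y ε) →
        blockSign (row b X) (row₀ b X) ≡ blockSign (row b Y) (row₀ b Y)
      blockSign-cong b {X} {Y} X⊑Y eq = sym (trans
        (blockSign-map id (sym (count-cong {f = row b X} {row b Y} eq))
          (λ _ _ → sym (σ-cong {row b X} {row b Y} eq))
          (λ _ ¬u → sym (σ-cong {row₀ b X} {row₀ b Y} (row₀-above b X (row-full b X ¬u) X⊑Y))))
        (map-id _))

      -- Rows only grow along the order, so equal totals force equal rows in every block; where a
      -- row is full, `row₀-above` freezes the substitute too.
      lowSign-same : ∀ {X Y} → X ⊑ Y → ρ X ≡ ρ Y → lowSign X ≡ lowSign Y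
      lowSign-same {X} {Y} X⊑Y eq = firstJust-cong zero λ b → blockSign-cong b X⊑Y
        (count-squeeze {f = row b X} {row b Y} (row-mono X⊑Y b)
          (sum-squeeze (λ b → count-mono {f = row b X} {row b Y} (row-mono X⊑Y b)) eq b))

      properSign-cong : ∀ {f g} → (∀ ε → f ε ≡ g ε) → properSign f ≡ properSign g
      properSign-cong {f} {g} eq = sym (trans
        (properSign-map id (sym (count-cong {f = f} {g} eq)) (λ _ → sym (σ-cong {f} {g} eq))) (map-id _))

      highSign-same : ∀ {X Y} → X ⊑ Y → η X ≡ η Y → highSign X ≡ highSign Y
      highSign-same {X} {Y} X⊑Y eq = firstJust-cong zero λ j → properSign-cong {hit j X} {hit j Y}
        (count-squeeze {f = hit j X} {hit j Y} (hit-mono X⊑Y j)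
          (sum-squeeze (λ j → count-mono {f = hit j X} {hit j Y} (hit-mono X⊑Y j)) eq j))

      -- The negation of the conclusion: no vector has sets of one colour in all p of its classes.
      -- It is what makes `σ` equivariant on the rows of colours.
      module _ (proper : ∀ X j → count (hit j X) < p) where
        properSign-act : ∀ j X → properSign (hit j (act X)) ≡ Maybe.map rot (properSign (hit j X))
        properSign-act j X = properSign-map rot (count-rot {hit j X} {hit j (act X)} (hit-act j X))
          (λ l → σ-rot {hit j X} {hit j (act X)} (hit-act j X) l (proper X j))

        highSign-act : ∀ X → p * k′ < ρ X → highSign (act X) ≡ rot (highSign X)
        highSign-act X lt = firstJust-map rot zero zero _ (λ j → properSign-act j X)
          (let j , ε , t = hit-exists X lt in j , _ , properSign-nonempty (count≥1 (hit j X) ε t))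

        η≥1 : ∀ X → p * k′ < ρ X → 1 ≤ η X
        η≥1 X lt = let j , ε , t = hit-exists X lt in ≤-trans (count≥1 (hit j X) ε t) (term≤sum (λ j → count (hit j X)) j)

        sgn : E width → Sign
        sgn X with ρ X ≤? p * k′
        ... | yes _ = lowSign X
        ... | no _ = highSign X

        level : E width → ℕ
        level X with ρ X ≤? p * k′
        ... | yes _ = ρ X
        ... | no _ = p * k′ + η X

        sgn-low : ∀ {X} → ρ X ≤ p * k′ → sgn X ≡ lowSign X
        sgn-low {X} le with ρ X ≤? p * k′
        ... | yes _ = refl
        ... | no gt = ⊥-elim (gt le)

        sgn-high : ∀ {X} → ¬ ρ X ≤ p * k′ → sgn X ≡ highSign X
        sgn-high {X} gt with ρ X ≤? p * k′
        ... | yes le = ⊥-elim (gt le)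
        ... | no _ = refl

        sgn-act : Equivariant sgn
        sgn-act X = [
            (λ le → trans (sgn-low (subst (_≤ p * k′) (sym (ρ-act X)) le))
              (trans (lowSign-act X) (cong rot (sym (sgn-low le))))) ,
            (λ gt → trans (sgn-high (gt ∘ subst (_≤ p * k′) (ρ-act X)))
              (trans (highSign-act X (≰⇒> gt)) (cong rot (sym (sgn-high gt))))) ]′
          (toSum (ρ X ≤? p * k′))

        level≥1 : ∀ X → 1 ≤ level X
        level≥1 X with ρ X ≤? p * k′
        ... | yes _ = ρ≥1 X
        ... | no gt = ≤-trans (η≥1 X (≰⇒> gt)) (m≤n+m _ _)

        level≤ : ∀ X → level X ≤ p * k′ + c * p′
        level≤ X with ρ X ≤? p * k′
        ... | yes le = ≤-trans le (m≤m+n _ _)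
        ... | no _ = +-monoʳ-≤ (p * k′) (sum≤ (λ j → s≤s⁻¹ (proper X j)))

        level-mono : ∀ {X Y} → X ⊑ Y → level X ≤ level Y
        level-mono {X} {Y} X⊑Y with ρ X ≤? p * k′ | ρ Y ≤? p * k′
        ... | yes _ | yes _ = ρ-mono X⊑Y
        ... | yes le | no _ = ≤-trans le (m≤m+n _ _)
        ... | no gt | yes le = ⊥-elim (gt (≤-trans (ρ-mono X⊑Y) le))
        ... | no _ | no _ = +-monoʳ-≤ (p * k′) (η-mono X⊑Y)

        sgn-same : ∀ {X Y} → X ⊑ Y → level X ≡ level Y → sgn X ≡ sgn Y
        sgn-same {X} {Y} X⊑Y eq with ρ X ≤? p * k′ | ρ Y ≤? p * k′
        ... | yes _ | yes _ = lowSign-same X⊑Y eq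
        -- Crossing the threshold raises the level strictly, because `η Y` is positive, so the two
        -- definitions of the sign are never compared.
        ... | yes le | no gt = ⊥-elim (<⇒≢ (≤-<-trans le (m<m+n (p * k′) (η≥1 Y (≰⇒> gt)))) eq)
        ... | no gt | yes le = ⊥-elim (gt (≤-trans (ρ-mono X⊑Y) le))
        ... | no _ | no _ = highSign-same X⊑Y (+-cancelˡ-≡ (p * k′) _ _ eq)

      -- Exhaustive search over the vectors either finds a full row of some colour, which is the
      -- family itself, or establishes `proper`.
      monochromatic : p * k′ + c * p′ ≤ m′ → Monochromatic p emb blk k col
      monochromatic le with anyE? (λ X → Fin.any? (λ j → Fin.all? (λ ε → T? (hit j X ε))))
      ... | yes (X , j , full) = assemble X j full
      ... | no none = ⊥-elim (no-levels p≥2 m′ (sgn proper) (sgn-act proper) (level proper)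
              (level≥1 proper) (λ X → ≤-trans (level≤ proper X) le) (level-mono proper) (sgn-same proper))
        where
        proper : ∀ X j → count (hit j X) < p
        proper X j = ≤∧≢⇒< (count≤n (hit j X)) (λ eq → none (X , j , count≡n⇒full (hit j X) eq))

  prime-AFL : ∀ {p} → Prime p → AFL p
  prime-AFL {suc p′} pr {m = suc m′} k′ c emb inj blk pos sep col lt =
    monochromatic p′ pr k′ c emb inj blk pos sep col (s≤s⁻¹ lt)

open import Defs
open ZrTucker
open Counting
open PrimeCase
open import Data.Nat as ℕ using (ℕ; zero; suc; _*_; _∸_; _≤_; _<_; _+_; _/_; _%_; s≤s; z≤n; NonZero)
open import Data.Nat.Properties as ℕ
open import Data.Nat.DivMod as ℕ
open import Data.Nat.Divisibility using (divides; hasNonTrivialDivisor)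
open import Data.Nat.Induction using (<-rec)
open import Data.Nat.Primality using (prime?; ¬prime⇒composite)
open import Data.Nat.Tactic.RingSolver using (solve-∀)
open import Data.Integer as ℤ using (ℤ; +_)
import Data.Integer.Properties as ℤ
import Data.Integer.Tactic.RingSolver as ℤ
open import Data.Fin as Fin using (Fin; zero; suc; toℕ; fromℕ<; combine; remQuot)
open import Data.Fin.Properties as Fin using (toℕ-fromℕ<; toℕ-injective; toℕ<n)
open import Data.Fin.Subset using (Subset; _∈_; _∩_; Empty)
open import Data.Fin.Subset.Properties using (_∈?_; x∈p∩q⁻; x∈p∩q⁺)
open import Data.Empty using (⊥-elim)
open import Data.Product
open import Function
open import Function.Definitions using (Injective)
open import Relation.Nullary
open import Relation.Nullary.Decidable using (_×-dec_)
open import Relation.Binary.Definitions using (tri<; tri≈; tri>)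
open import Relation.Binary.PropositionalEquality

-- From primes to all r.

-- Every block is cut into a sub-blocks of size at most b. A set transversal to the
-- sub-blocks meets each block at most a times, so the theorem for a applies inside it.
product-arith : ∀ a b .{{_ : NonZero a}} .{{_ : NonZero b}} k c →
  b * (a * k + c * (a ∸ 1)) + c * (b ∸ 1) ≡ a * b * k + c * (a * b ∸ 1)
product-arith (suc a) (suc b) k c = ring a b k c
  where ring : ∀ a b k c → (1 + b) * ((1 + a) * k + c * a) + c * b ≡ (1 + a) * (1 + b) * k + c * (b + a * (1 + b))
        ring = solve-∀

module Product (a b : ℕ) .{{_ : NonZero a}} .{{_ : NonZero b}} (afl-a : AFL a) (afl-b : AFL b)
  {n m q} (k′ c : ℕ) (emb : Fin m → Fin n) (emb-inj : Injective _≡_ _≡_ emb)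
  (blk : Fin m → Fin q) (pos : Fin m → Fin (a * b)) (sep : Separates blk pos)
  (col : ∀ F → Good emb blk (suc k′) F → Fin c) (lt : a * b * k′ + c * (a * b ∸ 1) < m) where

  -- One element more than this is exactly what the theorem for a asks of a ground set, so the outer
  -- problem looks for sets of size `suc size′`.
  size′ : ℕ
  size′ = a * k′ + c * (a ∸ 1)
  split : Fin (a * b) → Fin a × Fin b
  split = remQuot {a} b
  pos₁ : Fin m → Fin a
  pos₁ i = proj₁ (split (pos i))
  pos₂ : Fin m → Fin b
  pos₂ i = proj₂ (split (pos i))
  sub : Fin m → Fin (q * a)
  sub i = combine (blk i) (pos₁ i)

  sub-separates : Separates sub pos₂
  sub-separates {i} {j} eq eq₂ =
    let eq-blk , eq₁ = Fin.combine-injective (blk i) (pos₁ i) (blk j) (pos₁ j) eq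
    in sep eq-blk (trans (sym (Fin.combine-remQuot {a} b (pos i)))
         (trans (cong₂ combine eq₁ eq₂) (Fin.combine-remQuot {a} b (pos j))))

  module Inside (S : Subset n) (S-good : Good emb sub (suc size′) S) where
    h : Σ (Fin (suc size′) → Fin n) λ h → Injective _≡_ _≡_ h × (∀ i → h i ∈ S)
    h = enumerate-subset S (≤-reflexive (sym (S-good .size)))
    index : Fin (suc size′) → Fin m
    index i = proj₁ (S-good .support _ (proj₂ (proj₂ h) i))
    emb-index : ∀ i → emb (index i) ≡ proj₁ h i
    emb-index i = proj₂ (S-good .support _ (proj₂ (proj₂ h) i))
    embS : Fin (suc size′) → Fin n
    embS i = emb (index i)
    embS∈S : ∀ i → embS i ∈ S
    embS∈S i = subst (_∈ S) (sym (emb-index i)) (proj₂ (proj₂ h) i)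
    index-injective : Injective _≡_ _≡_ index
    index-injective {i} {j} eq =
      proj₁ (proj₂ h) (trans (sym (emb-index i)) (trans (cong emb eq) (emb-index j)))

    promote : ∀ {F} → Good embS (blk ∘ index) (suc k′) F → Good emb blk (suc k′) F
    promote g .size = g .size
    promote g .support x x∈F = let i , eq = g .support x x∈F in index i , eq
    promote {F} g .transversal i j i∈F j∈F eq =
      let i′ , ei = g .support _ i∈F
          j′ , ej = g .support _ j∈F
          i≡ = emb-inj ei
          j≡ = emb-inj ej
          i′≡j′ = g .transversal i′ j′ (subst (_∈ F) (sym ei) i∈F) (subst (_∈ F) (sym ej) j∈F)
                    (trans (cong blk i≡) (trans eq (cong blk (sym j≡))))
      in trans (sym i≡) (trans (cong index i′≡j′) j≡)

    colS : ∀ F → Good embS (blk ∘ index) (suc k′) F → Fin c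
    colS F g = col F (promote g)

    -- S meets each sub-block at most once, so inside a block its elements are told apart by the
    -- index `pos₁` of their sub-block. These indices serve as the a positions.
    solution : Monochromatic a embS (blk ∘ index) (suc k′) colS
    solution = afl-a k′ c embS (index-injective ∘ emb-inj) (blk ∘ index) (pos₁ ∘ index)
      (λ {i} {j} eq eq₁ → index-injective (S-good .transversal (index i) (index j) (embS∈S i) (embS∈S j) (cong₂ combine eq eq₁)))
      colS ≤-refl

    promoted : Monochromatic a emb blk (suc k′) col
    promoted .colour = solution .colour
    promoted .member = solution .member
    promoted .isGood α = promote (solution .isGood α)
    promoted .coloured = solution .coloured
    promoted .disjoint = solution .disjoint

    promoted⊆S : ∀ α x → x ∈ promoted .member α → x ∈ S
    promoted⊆S α x x∈ = let i , eq = solution .isGood α .support x x∈ in subst (_∈ S) eq (embS∈S i)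

  opaque
    -- In the outer problem, the colour of S is that of the family chosen here inside S. The same
    -- choice must be reused by `inner`, so that equal outer colours give equal inner ones.
    inside : ∀ S → Good emb sub (suc size′) S →
      Σ (Monochromatic a emb blk (suc k′) col) λ M → ∀ α x → x ∈ M .member α → x ∈ S
    inside S g = Inside.promoted S g , Inside.promoted⊆S S g

    outer : Monochromatic b emb sub (suc size′) (λ S g → proj₁ (inside S g) .colour)
    outer = afl-b size′ c emb emb-inj sub pos₂ sub-separates (λ S g → proj₁ (inside S g) .colour)
      (≤-trans (s≤s (≤-reflexive (product-arith a b k′ c))) lt)

  inner : Fin b → Monochromatic a emb blk (suc k′) col
  inner β = proj₁ (inside (outer .member β) (outer .isGood β))

  inner⊆ : ∀ β α x → x ∈ inner β .member α → x ∈ outer .member β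
  inner⊆ β = proj₂ (inside (outer .member β) (outer .isGood β))

  inner-disjoint : ∀ α α′ β β′ → Dec (β ≡ β′) → (α ≡ α′ → ¬ β ≡ β′) →
    Empty (inner β .member α ∩ inner β′ .member α′)
  inner-disjoint α α′ β .β (yes refl) ne = inner β .disjoint α α′ (λ eq → ne eq refl)
  inner-disjoint α α′ β β′ (no β≢β′) ne (x , x∈) =
    let x∈α , x∈α′ = x∈p∩q⁻ (inner β .member α) (inner β′ .member α′) x∈
    in outer .disjoint β β′ β≢β′ (x , x∈p∩q⁺ (inner⊆ β α x x∈α , inner⊆ β′ α′ x x∈α′))

  combined : Monochromatic (a * b) emb blk (suc k′) col
  combined .colour = outer .colour
  combined .member i = inner (proj₂ (split i)) .member (proj₁ (split i))
  combined .isGood i = inner (proj₂ (split i)) .isGood (proj₁ (split i))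
  combined .coloured i = trans (inner (proj₂ (split i)) .coloured (proj₁ (split i))) (outer .coloured (proj₂ (split i)))
  combined .disjoint i j i≢j = inner-disjoint _ _ _ _ (proj₂ (split i) Fin.≟ proj₂ (split j)) (λ eq₁ eq₂ → i≢j
    (trans (sym (Fin.combine-remQuot {a} b i)) (trans (cong₂ combine eq₁ eq₂) (Fin.combine-remQuot {a} b j))))

product-AFL : ∀ a b → .{{NonZero a}} → .{{NonZero b}} → AFL a → AFL b → AFL (a * b)
product-AFL a b afl-a afl-b k′ c emb emb-inj blk pos sep col lt =
  Product.combined a b afl-a afl-b k′ c emb emb-inj blk pos sep col lt

all-AFL : ∀ r → 2 ≤ r → AFL r
all-AFL = <-rec _ step
  where
  step : ∀ r → (∀ {s} → s < r → 2 ≤ s → AFL s) → 2 ≤ r → AFL r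
  step r rec r≥2 with prime? r
  ... | yes pr = prime-AFL pr
  ... | no ¬pr with ¬prime⇒composite {{ℕ.n>1⇒nonTrivial r≥2}} ¬pr
  ...   | hasNonTrivialDivisor {divisor = d} d<r (divides e eq) = subst AFL (sym eq)
            (product-AFL e d {{ℕ.>-nonZero (≤-trans (s≤s z≤n) e≥2)}} {{ℕ.>-nonZero (≤-trans (s≤s z≤n) d≥2)}}
              (rec e<r e≥2) (rec d<r d≥2))
    where
    d≥2 : 2 ≤ d
    d≥2 = ℕ.nonTrivial⇒n>1 d
    quotient≥2 : ∀ e → r ≡ e * d → 2 ≤ e
    quotient≥2 zero eq = ⊥-elim (<⇒≢ (≤-trans (s≤s z≤n) r≥2) (sym eq))
    quotient≥2 (suc zero) eq = ⊥-elim (<⇒≢ d<r (sym (trans eq (+-identityʳ d))))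
    quotient≥2 (suc (suc _)) _ = s≤s (s≤s z≤n)
    e≥2 : 2 ≤ e
    e≥2 = quotient≥2 e eq
    e<r : e < r
    e<r = subst (e <_) (sym eq) (m<m*n e d {{ℕ.>-nonZero (≤-trans (s≤s z≤n) e≥2)}} d≥2)

-- The lower bound: sets transversal to intervals of length r are wide.

residue-gap : ∀ m .{{_ : NonZero m}} {x y} → x % m ≡ y % m → x < y → x + m ≤ y
residue-gap m {x} {y} eq x<y = begin
  x + m                       ≡⟨ cong (_+ m) (ℕ.m≡m%n+[m/n]*n x m) ⟩
  x % m + x / m * m + m       ≡⟨ +-assoc (x % m) _ m ⟩
  x % m + (x / m * m + m)     ≡⟨ cong₂ _+_ eq (+-comm (x / m * m) m) ⟩
  y % m + suc (x / m) * m     ≤⟨ +-monoʳ-≤ (y % m) (*-monoˡ-≤ m (≰⇒> quotient)) ⟩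
  y % m + y / m * m           ≡⟨ ℕ.m≡m%n+[m/n]*n y m ⟨
  y                           ∎
  where
  open ≤-Reasoning
  quotient : ¬ y / m ≤ x / m
  quotient le = <⇒≱ x<y (begin
    y                   ≡⟨ ℕ.m≡m%n+[m/n]*n y m ⟩
    y % m + y / m * m   ≤⟨ +-mono-≤ (≤-reflexive (sym eq)) (*-monoˡ-≤ m le) ⟩
    x % m + x / m * m   ≡⟨ ℕ.m≡m%n+[m/n]*n x m ⟨
    x                   ∎)

-- Two of k + 1 distinct naturals are congruent modulo k.
spread : ∀ k (f : Fin (suc k) → ℕ) → Injective _≡_ _≡_ f → ∃₂ λ a b → f a + k ≤ f b
spread zero f inj = zero , zero , ≤-reflexive (+-identityʳ _)
spread (suc k) f inj
  with i , j , i<j , eq ← Fin.pigeonhole (n<1+n (suc k)) (λ i → fromℕ< (ℕ.m%n<n (f i) (suc k)))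
  with eq% ← trans (sym (toℕ-fromℕ< (ℕ.m%n<n (f i) (suc k)))) (trans (cong toℕ eq) (toℕ-fromℕ< (ℕ.m%n<n (f j) (suc k))))
  with <-cmp (f i) (f j)
... | tri< lt _ _ = i , j , residue-gap (suc k) eq% lt
... | tri≈ _ e _ = ⊥-elim (Fin.<⇒≢ i<j (inj e))
... | tri> _ _ gt = j , i , residue-gap (suc k) (sym eq%) gt

module Blocks (n r : ℕ) .{{_ : NonZero r}} where
  block : Fin n → Fin n
  block i = fromℕ< (≤-<-trans (ℕ.m/n≤m (toℕ i) r) (toℕ<n i))

  offset : Fin n → Fin r
  offset i = fromℕ< (ℕ.m%n<n (toℕ i) r)

  toℕ-block : ∀ i → toℕ (block i) ≡ toℕ i / r
  toℕ-block i = toℕ-fromℕ< _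

  block-offset : Separates block offset
  block-offset {i} {j} eb eo = toℕ-injective (begin
    toℕ i                              ≡⟨ ℕ.m≡m%n+[m/n]*n (toℕ i) r ⟩
    toℕ i % r + toℕ i / r * r          ≡⟨ cong₂ (λ x y → x + y * r) (sym (toℕ-fromℕ< _)) (sym (toℕ-block i)) ⟩
    toℕ (offset i) + toℕ (block i) * r ≡⟨ cong₂ (λ x y → toℕ x + toℕ y * r) eo eb ⟩
    toℕ (offset j) + toℕ (block j) * r ≡⟨ cong₂ (λ x y → x + y * r) (toℕ-fromℕ< _) (toℕ-block j) ⟩
    toℕ j % r + toℕ j / r * r          ≡⟨ ℕ.m≡m%n+[m/n]*n (toℕ j) r ⟨
    toℕ j                              ∎)
    where open ≡-Reasoning

  -- The k blocks met by a transversal set are distinct, so the outermost two are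
  -- k − 1 blocks apart and the set spans more than r (k − 2) + 1 places.
  good⇒wide : ∀ k′ t {F} → t ℤ.≤ + r ℤ.* (+ suc k′ ℤ.- + 2) ℤ.+ ℤ.1ℤ →
    Good id block (suc k′) F → IsWideVertex n (suc k′) t F
  good⇒wide k′ t {F} t≤ g = g .size , λ (i , _ , _ , inside) →
    let h , h-inj , h∈F = enumerate-subset F (≤-reflexive (sym (g .size)))
        a , b , apart = spread k′ (λ α → toℕ (block (h α)))
                          (λ eq → h-inj (g .transversal _ _ (h∈F _) (h∈F _) (toℕ-injective eq)))
        x = toℕ (h a)
        y = toℕ (h b)
        close = ℤ.drop‿+≤+ (within i x y (proj₁ (inside (h a) (h∈F a))) (proj₂ (inside (h b) (h∈F b))))
    in n≮n (y + r) (≤-trans close (far x y (subst₂ (λ u v → u + k′ ≤ v) (toℕ-block (h a)) (toℕ-block (h b)) apart)))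
    where
    -- x is at most r - 1 places beyond the start of its block, and y is not before the start of its
    -- own.
    far : ∀ x y → x / r + k′ ≤ y / r → suc x + r * k′ ≤ y + r
    far x y le = begin
      suc x + r * k′                     ≡⟨ cong (λ z → suc z + r * k′) (ℕ.m≡m%n+[m/n]*n x r) ⟩
      suc (x % r) + x / r * r + r * k′   ≤⟨ +-monoˡ-≤ (r * k′) (+-monoˡ-≤ (x / r * r) (ℕ.m%n<n x r)) ⟩
      r + x / r * r + r * k′             ≡⟨ ring r (x / r) k′ ⟩
      (x / r + k′) * r + r               ≤⟨ +-monoˡ-≤ r (≤-trans (*-monoˡ-≤ r le) (ℕ.m/n*n≤m y r)) ⟩
      y + r                              ∎
      where
      open ≤-Reasoning
      ring : ∀ r x k → r + x * r + r * k ≡ (x + k) * r + r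
      ring = solve-∀
    -- Adding r to both sides turns r (k - 2) into r (k - 1), so that the comparison can be finished
    -- in the natural numbers.
    within : ∀ i x y → i ℤ.≤ + suc x → + suc y ℤ.≤ i ℤ.+ t ℤ.- ℤ.1ℤ → + (suc y + r) ℤ.≤ + (suc x + r * k′)
    within i x y i≤x y≤ = begin
      + suc y ℤ.+ + r
        ≤⟨ ℤ.+-monoˡ-≤ (+ r) y≤ ⟩
      i ℤ.+ t ℤ.- ℤ.1ℤ ℤ.+ + r
        ≤⟨ ℤ.+-monoˡ-≤ (+ r) (ℤ.+-monoˡ-≤ (ℤ.- ℤ.1ℤ) (ℤ.+-mono-≤ i≤x t≤)) ⟩
      + suc x ℤ.+ (+ r ℤ.* (+ suc k′ ℤ.- + 2) ℤ.+ ℤ.1ℤ) ℤ.- ℤ.1ℤ ℤ.+ + r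
        ≡⟨ ring (+ suc x) (+ r) (+ k′) ⟩
      + suc x ℤ.+ + r ℤ.* + k′
        ≡⟨ cong (λ z → + suc x ℤ.+ z) (sym (ℤ.pos-* r k′)) ⟩
      + (suc x + r * k′) ∎
      where
      open ℤ.≤-Reasoning
      ring : ∀ x r k → x ℤ.+ (r ℤ.* (ℤ.1ℤ ℤ.+ k ℤ.- + 2) ℤ.+ ℤ.1ℤ) ℤ.- ℤ.1ℤ ℤ.+ r ≡ x ℤ.+ r ℤ.* k
      ring = ℤ.solve-∀

  no-colouring : 2 ≤ r → ∀ k′ t c → t ℤ.≤ + r ℤ.* (+ suc k′ ℤ.- + 2) ℤ.+ ℤ.1ℤ →
    r * k′ + c * (r ∸ 1) < n → ¬ Colourable n (suc k′) r t c
  no-colouring r≥2 k′ t c t≤ lt (col , proper) =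
    proper (mono .member) (λ a → good⇒wide k′ t t≤ (mono .isGood a)) (mono .disjoint)
      (λ a b → trans (mono .coloured a) (sym (mono .coloured b)))
    where
    mono : Monochromatic r id block (suc k′) (λ F g → col F (good⇒wide k′ t t≤ g))
    mono = all-AFL r r≥2 k′ c id id block offset block-offset _ lt

-- Colour a set by one of the first m blocks of size r − 1 that it meets, or by
-- zero if it meets none of them. The remaining ground set is too small for r disjoint k-sets.
module UpperBound (n k′ r′ m : ℕ) (t : ℤ) .{{_ : NonZero r′}} (small : n < m * r′ + suc r′ * suc k′) where
  private
    k = suc k′

  Meets : Subset n → Fin m → Set
  Meets F j = ∃ λ x → x ∈ F × toℕ x / r′ ≡ toℕ j

  meets? : ∀ F → Dec (∃ (Meets F))
  meets? F = Fin.any? λ j → Fin.any? λ x → (x ∈? F) ×-dec (toℕ x / r′ ℕ.≟ toℕ j)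

  tag : ∀ {F} → Dec (∃ (Meets F)) → Fin (suc m)
  tag (yes (j , _)) = suc j
  tag (no _) = zero

  tag-suc : ∀ {F j} (d : Dec (∃ (Meets F))) → tag d ≡ suc j → Meets F j
  tag-suc (yes (j , x)) refl = x

  tag-zero : ∀ {F} (d : Dec (∃ (Meets F))) → tag d ≡ zero → ∀ x → x ∈ F → m * r′ ≤ toℕ x
  tag-zero (no none) _ x x∈F with toℕ x / r′ ℕ.<? m
  ... | yes lt = ⊥-elim (none (fromℕ< lt , x , x∈F , sym (toℕ-fromℕ< lt)))
  ... | no ge = ≤-trans (*-monoˡ-≤ r′ (≮⇒≥ ge)) (ℕ.m/n*n≤m (toℕ x) r′)

  proper : ProperColouring n k (suc r′) t (suc m) (λ F _ → tag (meets? F))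
  proper F v disj same = by-tag (tag (meets? (F zero))) (λ a → same a zero)
    where
    shared : ∀ {a b x} → x ∈ F a → x ∈ F b → a ≡ b
    shared {a} {b} {x} x∈a x∈b with a Fin.≟ b
    ... | yes eq = eq
    ... | no ne = ⊥-elim (disj a b ne (x , x∈p∩q⁺ (x∈a , x∈b)))

    by-tag : ∀ e → ¬ (∀ a → tag (meets? (F a)) ≡ e)
    -- Disjoint sets meet the block in distinct elements, but r sets would share a block of r - 1
    -- elements.
    by-tag (suc j) eq = n≮n r′ (Fin.injective⇒≤ {f = residue} residue-injective)
      where
      met : ∀ a → Meets (F a) j
      met a = tag-suc (meets? (F a)) (eq a)
      residue : Fin (suc r′) → Fin r′
      residue a = fromℕ< (ℕ.m%n<n (toℕ (proj₁ (met a))) r′)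
      residue-injective : Injective _≡_ _≡_ residue
      residue-injective {a} {b} e =
        let x , x∈a , qx = met a
            y , y∈b , qy = met b
            rem = trans (sym (toℕ-fromℕ< (ℕ.m%n<n (toℕ x) r′))) (trans (cong toℕ e) (toℕ-fromℕ< (ℕ.m%n<n (toℕ y) r′)))
            x≡y = toℕ-injective {i = x} {y} (trans (ℕ.m≡m%n+[m/n]*n (toℕ x) r′)
                    (trans (cong₂ (λ u w → u + w * r′) rem (trans qx (sym qy))) (sym (ℕ.m≡m%n+[m/n]*n (toℕ y) r′))))
        in shared x∈a (subst (_∈ F b) (sym x≡y) y∈b)
    -- The r k elements of the sets all lie beyond the m blocks, where fewer than r k places remain.
    by-tag zero eq = <⇒≱ room (Fin.injective⇒≤ {f = place} place-injective)
      where
      h : ∀ a → Σ (Fin k → Fin n) λ h → Injective _≡_ _≡_ h × (∀ i → h i ∈ F a)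
      h a = enumerate-subset (F a) (≤-reflexive (sym (proj₁ (v a))))
      element : Fin (suc r′) × Fin k → Fin n
      element (a , i) = proj₁ (h a) i
      element∈ : ∀ p → element p ∈ F (proj₁ p)
      element∈ (a , i) = proj₂ (proj₂ (h a)) i
      high : ∀ p → m * r′ ≤ toℕ (element p)
      high p = tag-zero (meets? (F (proj₁ p))) (eq (proj₁ p)) (element p) (element∈ p)
      below : ∀ p → toℕ (element p) ∸ m * r′ < n ∸ m * r′
      below p = ∸-monoˡ-< (toℕ<n (element p)) (high p)
      place : Fin (suc r′ * k) → Fin (n ∸ m * r′)
      place s = fromℕ< (below (remQuot k s))
      element-injective : ∀ p p′ → element p ≡ element p′ → p ≡ p′
      element-injective p@(a , i) p′@(b , j) e with shared (element∈ p) (subst (_∈ F b) (sym e) (element∈ p′))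
      ... | refl = cong (a ,_) (proj₁ (proj₂ (h a)) e)
      place-injective : Injective _≡_ _≡_ place
      place-injective {s} {s′} e =
        trans (sym (Fin.combine-remQuot {suc r′} k s)) (trans (cong (uncurry combine) (element-injective p p′
          (toℕ-injective (∸-cancelʳ-≡ (high p) (high p′)
            (trans (sym (toℕ-fromℕ< (below p))) (trans (cong toℕ e) (toℕ-fromℕ< (below p′))))))))
          (Fin.combine-remQuot {suc r′} k s′))
        where p = remQuot k s
              p′ = remQuot k s′
      room : n ∸ m * r′ < suc r′ * k
      room with m * r′ ℕ.≤? n
      ... | yes le = +-cancelʳ-< (m * r′) _ _ (subst₂ _<_ (sym (m∸n+n≡m le)) (+-comm (m * r′) _) small)
      -- The blocks more than cover the ground set, and truncated subtraction leaves 0 places.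
      ... | no gt rewrite m≤n⇒m∸n≡0 (<⇒≤ (≰⇒> gt)) = s≤s z≤n

  colourable : Colourable n k (suc r′) t (suc m)
  colourable = (λ F _ → tag (meets? F)) , proper

-- Ceilings, and the chromatic number.

a≤⌈a/d⌉*d : ∀ a d .{{_ : NonZero d}} → a ≤ ⌈ a / d ⌉ * d
a≤⌈a/d⌉*d a d@(suc d′) = +-cancelʳ-≤ d′ _ _ (begin
  a + d′                              ≡⟨ ℕ.m≡m%n+[m/n]*n (a + d′) d ⟩
  (a + d′) % d + ⌈ a / d ⌉ * d        ≤⟨ +-monoˡ-≤ (⌈ a / d ⌉ * d) (ℕ.s≤s⁻¹ (ℕ.m%n<n (a + d′) d)) ⟩
  d′ + ⌈ a / d ⌉ * d                  ≡⟨ +-comm d′ _ ⟩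
  ⌈ a / d ⌉ * d + d′                  ∎)
  where open ≤-Reasoning

⌈a/d⌉≤c : ∀ a d c .{{_ : NonZero d}} → a ≤ c * d → ⌈ a / d ⌉ ≤ c
⌈a/d⌉≤c a d@(suc d′) c le = ℕ.s≤s⁻¹ (ℕ.m<n*o⇒m/o<n (begin-strict
  a + d′        <⟨ +-monoʳ-< a (n<1+n d′) ⟩
  a + d         ≤⟨ +-monoˡ-≤ d le ⟩
  c * d + d     ≡⟨ +-comm (c * d) d ⟩
  suc c * d     ∎))
  where open ≤-Reasoning

theorem9 : (n k r : ℕ) (t : ℤ) → 1 ≤ k → (r≥2 : 2 ≤ r) → r * k ≤ n →
    t ℤ.≤ + r ℤ.* (+ k ℤ.- + 2) ℤ.+ ℤ.1ℤ →
    ChromaticNumberIs n k r t (⌈_/_⌉ (n ∸ r * (k ∸ 1)) (r ∸ 1) {{pred-nonZero r≥2}})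
theorem9 n (suc k′) r@(suc r′@(suc _)) t _ r≥2@(s≤s (s≤s _)) rk≤n t≤ = upper ⌈ a / r′ ⌉ (a≤⌈a/d⌉*d a r′) , lower
  where
  a : ℕ
  a = n ∸ r * k′

  a+rk′≡n : a + r * k′ ≡ n
  a+rk′≡n = m∸n+n≡m (≤-trans (*-monoʳ-≤ r (n≤1+n k′)) rk≤n)

  r≤a : r ≤ a
  r≤a = +-cancelʳ-≤ (r * k′) _ _ (≤-trans (≤-reflexive (sym (*-suc r k′))) (≤-trans rk≤n (≤-reflexive (sym a+rk′≡n))))

  upper : ∀ m → a ≤ m * r′ → Colourable n (suc k′) r t m
  -- One colour is reserved for the sets that meet no block, so m + 1 colours leave m blocks. Zero
  -- colours cannot occur, since n ≥ r k gives a ≥ r.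
  upper zero a≤0 = ⊥-elim (n≮0 (≤-trans r≤a a≤0))
  upper (suc m) a≤ = UpperBound.colourable n k′ r′ m t (begin-strict
    n                               ≡⟨ a+rk′≡n ⟨
    a + r * k′                      ≤⟨ +-monoˡ-≤ (r * k′) a≤ ⟩
    r′ + m * r′ + r * k′            <⟨ n<1+n _ ⟩
    suc (r′ + m * r′ + r * k′)      ≡⟨ ring r′ m k′ ⟩
    m * r′ + r * suc k′             ∎)
    where
    open ≤-Reasoning
    ring : ∀ r m k → 1 + (r + m * r + (1 + r) * k) ≡ m * r + (1 + r) * (1 + k)
    ring = solve-∀

  lower : ∀ c → Colourable n (suc k′) r t c → ⌈ a / r′ ⌉ ≤ c
  lower c colourable with a ℕ.≤? c * r′
  ... | yes a≤ = ⌈a/d⌉≤c a r′ c a≤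
  ... | no a≰ = ⊥-elim (Blocks.no-colouring n r r≥2 k′ t c t≤ (begin-strict
    r * k′ + c * r′     <⟨ +-monoʳ-< (r * k′) (≰⇒> a≰) ⟩
    r * k′ + a          ≡⟨ +-comm (r * k′) a ⟩
    a + r * k′          ≡⟨ a+rk′≡n ⟩
    n                   ∎) colourable)
    where open ≤-Reasoning
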